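{- Let $G_1$ and $G_2$ be finite graphs. Then $\mathcal{B}(G_1)\cong\mathcal{B}(G_2)$ if and only if $G_1'\cong G_2'$, where $G_i'$ is the graph obtained from $G_i$ by removing all universal vertices.
   Context: All graphs are finite and simple. A vertex of $G$ is universal if it has degree $|V(G)|-1$. An independent set partition of $G$ is a partition of $V(G)$ into nonempty independent sets (parts). For such a partition $P$ and $v\in V(G)$, let $P-v$ be the partition of $V(G)\setminus\{v\}$ obtained by deleting $v$ from its part (discarding that part if it becomes empty). The Bell colouring graph $\mathcal{B}(G)$ has as vertices the independent set partitions of $G$, with $P\neq Q$ adjacent iff $P-v=Q-v$ for some $v\in V(G)$. -}

module Defs where

open import Data.Nat using (ℕ)
open import Data.Fin using (Fin) renaming (_≟_ to _≟F_)
open import Data.Bool using (Bool; true; false; _∧_; _∨_; not; T) renaming (_≟_ to _≟B_)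
open import Data.List.Base using (allFin; foldr; map)
open import Data.Vec using (Vec; lookup)
open import Data.Product using (Σ; ∃; _×_; proj₁)
open import Relation.Nullary using (¬_)
open import Relation.Nullary.Decidable using (⌊_⌋)
open import Relation.Binary.PropositionalEquality using (_≡_)
open import Function.Bundles using (_↔_; _⇔_; Inverse)

allF : {n : ℕ} → (Fin n → Bool) → Bool
allF {n} f = foldr _∧_ true (map f (allFin n))

record SimpleGraph (n : ℕ) : Set where
  field
    adj    : Fin n → Fin n → Bool
    sym    : ∀ u v → adj u v ≡ adj v u
    irrefl : ∀ v → adj v v ≡ false
open SimpleGraph public

record Graph : Set₁ where
  field
    V : Set
    E : V → V → Set
open Graph public

_≅_ : Graph → Graph → Set
G ≅ H = Σ (V G ↔ V H) λ f → ∀ u v → E G u v ⇔ E H (Inverse.to f u) (Inverse.to f v)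

isUniversal : {n : ℕ} → SimpleGraph n → Fin n → Bool
isUniversal G v = allF λ u → ⌊ u ≟F v ⌋ ∨ adj G v u

removeUniversal : {n : ℕ} → SimpleGraph n → Graph
removeUniversal {n} G = record
  { V = Σ (Fin n) (λ v → T (not (isUniversal G v)))
  ; E = λ u w → T (adj G (proj₁ u) (proj₁ w))
  }

-- A partition of Fin n is encoded canonically by its "same part" relation,
-- stored as an n×n Boolean matrix that must be an equivalence relation.
Matrix : ℕ → Set
Matrix n = Vec (Vec Bool n) n

_[_,_] : {n : ℕ} → Matrix n → Fin n → Fin n → Bool
R [ u , w ] = lookup (lookup R u) w

isEquivalenceMatrix : {n : ℕ} → Matrix n → Bool
isEquivalenceMatrix R =
  allF λ u → R [ u , u ] ∧
  (allF λ w → ⌊ R [ u , w ] ≟B R [ w , u ] ⌋ ∧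
  (allF λ x → not (R [ u , w ] ∧ R [ w , x ]) ∨ R [ u , x ]))

partsIndependent : {n : ℕ} → SimpleGraph n → Matrix n → Bool
partsIndependent G R = allF λ u → allF λ w → not (R [ u , w ] ∧ adj G u w)

isIndepSetPartition : {n : ℕ} → SimpleGraph n → Matrix n → Bool
isIndepSetPartition G R = isEquivalenceMatrix R ∧ partsIndependent G R

IndepPartition : {n : ℕ} → SimpleGraph n → Set
IndepPartition {n} G = Σ (Matrix n) (λ R → T (isIndepSetPartition G R))

sameAfterDeleting : {n : ℕ} → Matrix n → Matrix n → Fin n → Set
sameAfterDeleting P Q v =
  ∀ u w → ¬ (u ≡ v) → ¬ (w ≡ v) → P [ u , w ] ≡ Q [ u , w ]

Bell : {n : ℕ} → SimpleGraph n → Graph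
Bell {n} G = record
  { V = IndepPartition G
  ; E = λ P Q → ¬ (P ≡ Q) × ∃ λ (v : Fin n) → sameAfterDeleting (proj₁ P) (proj₁ Q) v
  }

{-# OPTIONS --safe #-}
module Submission where

-- Write H for the complement of G. The neighbours of the discrete partition in Bell G are the
-- edges of H, and two of them are adjacent iff the edges meet; vertices at distance two tell
-- triangles from stars, so by Whitney's argument the neighbourhood determines H up to isolated
-- vertices, i.e. G up to universal vertices. The discrete partition cannot be recognised in Bell G
-- (if H is a triangle, it has a twin, the one-block partition), but it has local properties
-- (LocallyDiscrete) that an isomorphism carries over to its image P in Bell G₂. These properties
-- force the blocks of P with at least two elements to be almost isolated (Tame), and then the
-- neighbours of P can still be labelled by edges of H₂ in the way described. Two labellings of the
-- same neighbourhood, by edges of H₁ and of H₂, embed H₁ without its isolated vertices into H₂.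
-- By symmetry there is an embedding in the other direction, and both graphs are finite.
-- Conversely, a universal vertex is a singleton in every independent set partition.

open import Defs
open import Data.Bool using (Bool; true; false; _∧_; _∨_; not; T; if_then_else_) renaming (_≟_ to _≟B_)
open import Data.Bool.Properties using (T-≡; T-∧; T-∨; T-not-≡; T-irrelevant; T?; ¬-not; not-¬)
open import Data.Empty using (⊥)
open import Data.Fin using (Fin; toℕ; _<_) renaming (_≟_ to _≟F_)
open import Data.Fin.Properties using (any?; <-cmp; <-asym; pigeonhole)
open import Data.List.Base using (List; []; _∷_; allFin)
import Data.List.Membership.DecPropositional as DecMembership
open import Data.List.Membership.Propositional using (_∈_; _∉_)
open import Data.List.Membership.Propositional.Properties using (∈-allFin)
import Data.List.Relation.Unary.All as All
open import Data.List.Relation.Unary.All.Properties using (all⁺; all⁻)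
open import Data.List.Relation.Unary.Any using (here; there)
open import Data.Nat using (ℕ; zero; suc; _+_; _*_)
open import Data.Nat.GeneralisedArithmetic using (fold; fold-+)
open import Data.Nat.Properties using (+-suc; *-comm; n<1+n; m≤n⇒∃[o]m+o≡n)
open import Data.Product using (∃; ∃₂; _×_; _,_; proj₁; proj₂)
open import Data.Sum using (_⊎_; inj₁; inj₂; [_,_]′)
open import Data.Vec using (Vec; lookup; tabulate)
open import Data.Vec.Properties using (lookup∘tabulate; tabulate∘lookup; tabulate-cong)
open import Function.Base using (_∘_; id)
open import Function.Bundles using (_⇔_; Equivalence; Inverse; mk⇔; mk↔ₛ′)
open import Relation.Binary.Definitions using (Tri; tri<; tri≈; tri>)
open import Relation.Binary.PropositionalEquality as ≡ using (_≡_; _≢_; refl; trans; cong; cong₂; subst; subst₂; ≢-sym)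
open import Relation.Nullary using (¬_; Dec; yes; no; contradiction)
open import Relation.Nullary.Decidable using (⌊_⌋; True; does; toWitness; fromWitness; dec-true; dec-false)
open import Relation.Nullary.Decidable using (map′; ¬?; _×-dec_)

open Equivalence using (to; from)

-- A single move never leaves a component of H, so `Bell G` is the Cartesian product of the graphs
-- that belong to the components of H. `Tame` describes the partitions that are discrete except in
-- some components of two kinds, where the nontrivial block is a whole triangle or the central edge
-- xy of a double star. In the factor of such a component the changed partition and the discrete one
-- have the same neighbours, apart from each other: moving x to a leaf, say, yields the same
-- partition from either. Interchanging the two therefore carries the neighbours of P to those of
-- the discrete partition, together with their labels. The proof never forms the product. It argues
-- with movers instead: a vertex whose deletion makes two partitions equal lies in every pair of
-- vertices that exactly one of the two joins.

true≢false : {a : Bool} → a ≡ true → a ≢ false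
true≢false refl ()

≡-from-implications : {a b : Bool} → (a ≡ true → b ≡ true) → (b ≡ true → a ≡ true) → a ≡ b
≡-from-implications {true}  f g = ≡.sym (f refl)
≡-from-implications {false} {true}  f g = g refl
≡-from-implications {false} {false} f g = refl

allF⁻ : {n : ℕ} (f : Fin n → Bool) → T (allF f) → ∀ i → T (f i)
allF⁻ {n} f t i = All.lookup (all⁺ f (allFin n) t) (∈-allFin i)

allF⁺ : {n : ℕ} (f : Fin n → Bool) → (∀ i → T (f i)) → T (allF f)
allF⁺ {n} f h = all⁻ f (All.universal h (allFin n))

T-⇒⁻ : {a b : Bool} → T (not a ∨ b) → a ≡ true → b ≡ true
T-⇒⁻ t refl = to T-≡ t

T-⇒⁺ : {a b : Bool} → (a ≡ true → b ≡ true) → T (not a ∨ b)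
T-⇒⁺ {true}  f = from T-≡ (f refl)
T-⇒⁺ {false} f = _

∧-true : {a b : Bool} → a ≡ true → b ≡ true → a ∧ b ≡ true
∧-true refl refl = refl

∧-true⁻ : {a b : Bool} → a ∧ b ≡ true → a ≡ true × b ≡ true
∧-true⁻ {true} {true} refl = refl , refl

lookup-ext : {A : Set} {n : ℕ} {xs ys : Vec A n} → (∀ i → lookup xs i ≡ lookup ys i) → xs ≡ ys
lookup-ext {xs = xs} {ys} h = trans (≡.sym (tabulate∘lookup xs)) (trans (tabulate-cong h) (tabulate∘lookup ys))

-- Independent set partitions and the carving of blocks

module Partitions {n : ℕ} (G : SimpleGraph n) where

  Part : Set
  Part = IndepPartition G

  Coadj : Fin n → Fin n → Set
  Coadj u w = u ≢ w × adj G u w ≡ false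

  coadj-sym : ∀ {u w} → Coadj u w → Coadj w u
  coadj-sym {u} {w} (u≢w , h) = ≢-sym u≢w , trans (sym G w u) h

  coadj? : ∀ u w → Dec (Coadj u w)
  coadj? u w = ¬? (u ≟F w) ×-dec (adj G u w ≟B false)

  opaque
    at : Part → Fin n → Fin n → Bool
    at P u w = proj₁ P [ u , w ]

  infix 4 _∋_~_
  _∋_~_ : Part → Fin n → Fin n → Set
  P ∋ u ~ w = at P u w ≡ true

  module _ (P : Part) where
    opaque
      unfolding at

      private
        split : T (isEquivalenceMatrix (proj₁ P)) × T (partsIndependent G (proj₁ P))
        split = to T-∧ (proj₂ P)

        row : ∀ u → T (at P u u) × T (allF λ w → ⌊ at P u w ≟B at P w u ⌋ ∧
                                     (allF λ x → not (at P u w ∧ at P w x) ∨ at P u x))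
        row u = to T-∧ (allF⁻ _ (proj₁ split) u)

      ~-refl : ∀ {u} → P ∋ u ~ u
      ~-refl {u} = to T-≡ (proj₁ (row u))

      at-sym : ∀ u w → at P u w ≡ at P w u
      at-sym u w = toWitness {a? = at P u w ≟B at P w u} (proj₁ (to T-∧ (allF⁻ _ (proj₂ (row u)) w)))

      ~-sym : ∀ {u w} → P ∋ u ~ w → P ∋ w ~ u
      ~-sym {u} {w} = trans (at-sym w u)

      ~-trans : ∀ {u w x} → P ∋ u ~ w → P ∋ w ~ x → P ∋ u ~ x
      ~-trans {u} {w} {x} p q =
        T-⇒⁻ (allF⁻ _ (proj₂ (to (T-∧ {⌊ at P u w ≟B at P w u ⌋}) (allF⁻ _ (proj₂ (row u)) w))) x) (∧-true p q)

      ~-indep : ∀ {u w} → P ∋ u ~ w → adj G u w ≡ false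
      ~-indep {u} {w} p = to T-not-≡ (subst (λ b → T (not (b ∧ adj G u w))) p (allF⁻ _ (allF⁻ _ (proj₂ split) u) w))

      ~-coadj : ∀ {u w} → u ≢ w → P ∋ u ~ w → Coadj u w
      ~-coadj u≢w p = u≢w , ~-indep p

  related? : ∀ P u w → Dec (P ∋ u ~ w)
  related? P u w = at P u w ≟B true

  opaque
    unfolding at

    part-≡ : {P Q : Part} → (∀ u w → at P u w ≡ at Q u w) → P ≡ Q
    part-≡ {R , p} {S , q} h with lookup-ext {xs = R} {S} (λ u → lookup-ext (h u))
    ... | refl = cong (R ,_) (T-irrelevant p q)

  module _ (r : Fin n → Fin n → Bool)
           (r-refl : ∀ u → r u u ≡ true)
           (r-sym : ∀ u w → r u w ≡ true → r w u ≡ true)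
           (r-trans : ∀ u w x → r u w ≡ true → r w x ≡ true → r u x ≡ true)
           (r-indep : ∀ u w → r u w ≡ true → adj G u w ≡ false) where
    opaque
      unfolding at

      private
        R : Matrix n
        R = tabulate λ u → tabulate (r u)

        R-at : ∀ u w → R [ u , w ] ≡ r u w
        R-at u w = trans (cong (λ v → lookup v w) (lookup∘tabulate (λ u → tabulate (r u)) u)) (lookup∘tabulate (r u) w)

        R⇒r : ∀ {u w} → R [ u , w ] ≡ true → r u w ≡ true
        R⇒r {u} {w} = trans (≡.sym (R-at u w))

        r⇒R : ∀ {u w} → r u w ≡ true → R [ u , w ] ≡ true
        r⇒R {u} {w} = trans (R-at u w)

      fromRelation : Part
      fromRelation = R , from T-∧ (equivalence , independent)
        where
        equivalence : T (isEquivalenceMatrix R)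
        equivalence = allF⁺ _ λ u → from T-∧ (from T-≡ (r⇒R (r-refl u)) , allF⁺ _ λ w → from T-∧
          ( fromWitness {a? = R [ u , w ] ≟B R [ w , u ]}
              (≡-from-implications (r⇒R ∘ r-sym u w ∘ R⇒r) (r⇒R ∘ r-sym w u ∘ R⇒r))
          , allF⁺ _ λ x → T-⇒⁺ {R [ u , w ] ∧ R [ w , x ]} λ h →
              let p , q = ∧-true⁻ h in r⇒R (r-trans u w x (R⇒r p) (R⇒r q)) ))

        independent : T (partsIndependent G R)
        independent = allF⁺ _ λ u → allF⁺ _ λ w → from T-not-≡ (¬-not λ h →
          let p , q = ∧-true⁻ h in true≢false q (r-indep u w (R⇒r p)))

      fromRelation-at : ∀ u w → at fromRelation u w ≡ r u w
      fromRelation-at = R-at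

  private
    does-≡ : ∀ {u w : Fin n} → does (u ≟F w) ≡ true → u ≡ w
    does-≡ {u} {w} h with yes e ← u ≟F w = e

    δ : Fin n → Fin n → Bool
    δ u w = does (u ≟F w)

    δ-refl : ∀ u → δ u u ≡ true
    δ-refl u = dec-true (u ≟F u) refl

    δ-sym : ∀ u w → δ u w ≡ true → δ w u ≡ true
    δ-sym u w h = dec-true (w ≟F u) (≡.sym (does-≡ h))

    δ-trans : ∀ u w x → δ u w ≡ true → δ w x ≡ true → δ u x ≡ true
    δ-trans u w x h k = dec-true (u ≟F x) (trans (does-≡ h) (does-≡ k))

    δ-indep : ∀ u w → δ u w ≡ true → adj G u w ≡ false
    δ-indep u w h = subst (λ w → adj G u w ≡ false) (does-≡ h) (irrefl G u)

  discrete : Part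
  discrete = fromRelation δ δ-refl δ-sym δ-trans δ-indep

  discrete-~ : ∀ {u w} → discrete ∋ u ~ w → u ≡ w
  discrete-~ {u} {w} h = does-≡ (trans (≡.sym (fromRelation-at δ δ-refl δ-sym δ-trans δ-indep u w)) h)

  open DecMembership (_≟F_ {n}) using (_∈?_)

  Indep : List (Fin n) → Set
  Indep K = ∀ u w → u ∈ K → w ∈ K → adj G u w ≡ false

  module _ (P : Part) (K : List (Fin n)) (K-indep : Indep K) where
    private
      r : Fin n → Fin n → Bool
      r u w = if does (u ∈? K) then does (w ∈? K) else (if does (w ∈? K) then false else at P u w)

      r-inv : ∀ u w → r u w ≡ true → (u ∈ K × w ∈ K) ⊎ (u ∉ K × w ∉ K × P ∋ u ~ w)
      r-inv u w h with u ∈? K | w ∈? K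
      ... | yes p | yes q = inj₁ (p , q)
      ... | no p  | no q  = inj₂ (p , q , h)

      r-in : ∀ u w → u ∈ K → w ∈ K → r u w ≡ true
      r-in u w p q rewrite dec-true (u ∈? K) p | dec-true (w ∈? K) q = refl

      r-off : ∀ u w → u ∉ K → w ∉ K → r u w ≡ at P u w
      r-off u w p q rewrite dec-false (u ∈? K) p | dec-false (w ∈? K) q = refl

      r-refl : ∀ u → r u u ≡ true
      r-refl u with u ∈? K
      ... | yes _ = refl
      ... | no _  = ~-refl P

      r-sym : ∀ u w → r u w ≡ true → r w u ≡ true
      r-sym u w h with r-inv u w h
      ... | inj₁ (p , q)     = r-in w u q p
      ... | inj₂ (p , q , g) = trans (r-off w u q p) (~-sym P g)

      r-trans : ∀ u w x → r u w ≡ true → r w x ≡ true → r u x ≡ true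
      r-trans u w x h k with r-inv u w h | r-inv w x k
      ... | inj₁ (p , _)     | inj₁ (_ , q)      = r-in u x p q
      ... | inj₁ (_ , q)     | inj₂ (q′ , _)     = contradiction q q′
      ... | inj₂ (_ , q , _) | inj₁ (q′ , _)     = contradiction q′ q
      ... | inj₂ (p , _ , g) | inj₂ (_ , q , g′) = trans (r-off u x p q) (~-trans P g g′)

      r-indep : ∀ u w → r u w ≡ true → adj G u w ≡ false
      r-indep u w h with r-inv u w h
      ... | inj₁ (p , q)     = K-indep u w p q
      ... | inj₂ (_ , _ , g) = ~-indep P g

    opaque
      -- K becomes a block and the other blocks lose their elements in K. The partitions that the
      -- local arguments construct are obtained by iterating this operation, and many of their
      -- adjacencies reduce to `carve-agree`.
      carve : Part
      carve = fromRelation r r-refl r-sym r-trans r-indep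

      private
        carve-at : ∀ u w → at carve u w ≡ r u w
        carve-at = fromRelation-at r r-refl r-sym r-trans r-indep

    carve-inv : ∀ {u w} → carve ∋ u ~ w → (u ∈ K × w ∈ K) ⊎ (u ∉ K × w ∉ K × P ∋ u ~ w)
    carve-inv {u} {w} h = r-inv u w (trans (≡.sym (carve-at u w)) h)

    carve-in : ∀ {u w} → u ∈ K → w ∈ K → carve ∋ u ~ w
    carve-in {u} {w} p q = trans (carve-at u w) (r-in u w p q)

    carve-off : ∀ {u w} → u ∉ K → w ∉ K → at carve u w ≡ at P u w
    carve-off {u} {w} p q = trans (carve-at u w) (r-off u w p q)

    carve-out : ∀ {u w} → u ∈ K → w ∉ K → at carve u w ≡ false
    carve-out {u} {w} p q = ¬-not λ h → [ (λ (_ , q′) → q q′) , (λ (p′ , _) → p′ p) ]′ (carve-inv h)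

  singleton-indep : ∀ x → Indep (x ∷ [])
  singleton-indep x _ _ (here refl) (here refl) = irrefl G x

  pair-indep : ∀ {x y} → Coadj x y → Indep (x ∷ y ∷ [])
  pair-indep {x} c _ _ (here refl) (here refl) = irrefl G x
  pair-indep c _ _ (here refl) (there (here refl)) = proj₂ c
  pair-indep c _ _ (there (here refl)) (here refl) = proj₂ (coadj-sym c)
  pair-indep {y = y} c _ _ (there p) (there q) = singleton-indep y _ _ p q

  triple-indep : ∀ {x y z} → Coadj x y → Coadj x z → Coadj y z → Indep (x ∷ y ∷ z ∷ [])
  triple-indep {x} a b c _ _ (here refl) (here refl) = irrefl G x
  triple-indep a b c _ _ (here refl) (there (here refl)) = proj₂ a
  triple-indep a b c _ _ (here refl) (there (there (here refl))) = proj₂ b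
  triple-indep a b c _ _ (there (here refl)) (here refl) = proj₂ (coadj-sym a)
  triple-indep a b c _ _ (there (there (here refl))) (here refl) = proj₂ (coadj-sym b)
  triple-indep a b c _ _ (there p) (there q) = pair-indep c _ _ p q

  isolate : Part → Fin n → Part
  isolate P x = carve P (x ∷ []) (singleton-indep x)

  -- Not the union of two blocks: x and y leave their blocks and form one of their own. This is a
  -- single move when one of them was alone (`merge-agree`).
  merge : Part → ∀ {x y} → Coadj x y → Part
  merge P {x} {y} c = carve P (x ∷ y ∷ []) (pair-indep c)

  ∉₁ : {u x : Fin n} → u ≢ x → u ∉ x ∷ []
  ∉₁ p (here q) = p q

  ∉₂ : {u x y : Fin n} → u ≢ x → u ≢ y → u ∉ x ∷ y ∷ []
  ∉₂ p p′ (here q)  = p q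
  ∉₂ p p′ (there q) = ∉₁ p′ q

  ∉₃ : {u x y z : Fin n} → u ≢ x → u ≢ y → u ≢ z → u ∉ x ∷ y ∷ z ∷ []
  ∉₃ p p′ p″ (here q)  = p q
  ∉₃ p p′ p″ (there q) = ∉₂ p′ p″ q

  isolate-inv : ∀ {P x u w} → u ≢ w → isolate P x ∋ u ~ w → u ≢ x × w ≢ x × P ∋ u ~ w
  isolate-inv {P} {x} u≢w h with carve-inv P (x ∷ []) (singleton-indep x) h
  ... | inj₁ (here refl , here refl) = contradiction refl u≢w
  ... | inj₂ (p , q , k)             = p ∘ here , q ∘ here , k

  isolate-off : ∀ {P x u w} → u ≢ x → w ≢ x → at (isolate P x) u w ≡ at P u w
  isolate-off {P} {x} p q = carve-off P (x ∷ []) (singleton-indep x) (∉₁ p) (∉₁ q)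

  isolate-out : ∀ {P x w} → w ≢ x → at (isolate P x) x w ≡ false
  isolate-out {P} {x} p = carve-out P (x ∷ []) (singleton-indep x) (here refl) (∉₁ p)

  merge-inv : ∀ {P x y u w} (c : Coadj x y) → u ≢ w → merge P c ∋ u ~ w →
    (u ≡ x × w ≡ y ⊎ u ≡ y × w ≡ x) ⊎ (u ≢ x × u ≢ y × w ≢ x × w ≢ y × P ∋ u ~ w)
  merge-inv {P} {x} {y} c u≢w h with carve-inv P (x ∷ y ∷ []) (pair-indep c) h
  ... | inj₁ (here refl , here refl)                 = contradiction refl u≢w
  ... | inj₁ (here p , there (here q))               = inj₁ (inj₁ (p , q))
  ... | inj₁ (there (here p) , here q)               = inj₁ (inj₂ (p , q))
  ... | inj₁ (there (here refl) , there (here refl)) = contradiction refl u≢w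
  ... | inj₂ (p , q , k) = inj₂ (p ∘ here , p ∘ there ∘ here , q ∘ here , q ∘ there ∘ here , k)

  merge-in : ∀ {P x y} (c : Coadj x y) → merge P c ∋ x ~ y
  merge-in {P} {x} {y} c = carve-in P (x ∷ y ∷ []) (pair-indep c) (here refl) (there (here refl))

  merge-off : ∀ {P x y u w} (c : Coadj x y) → u ≢ x → u ≢ y → w ≢ x → w ≢ y → at (merge P c) u w ≡ at P u w
  merge-off {P} {x} {y} c p p′ q q′ = carve-off P (x ∷ y ∷ []) (pair-indep c) (∉₂ p p′) (∉₂ q q′)

  merge-out₁ : ∀ {P x y w} (c : Coadj x y) → w ≢ x → w ≢ y → at (merge P c) x w ≡ false
  merge-out₁ {P} {x} {y} c p q = carve-out P (x ∷ y ∷ []) (pair-indep c) (here refl) (∉₂ p q)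

  merge-out₂ : ∀ {P x y w} (c : Coadj x y) → w ≢ x → w ≢ y → at (merge P c) y w ≡ false
  merge-out₂ {P} {x} {y} c p q = carve-out P (x ∷ y ∷ []) (pair-indep c) (there (here refl)) (∉₂ p q)

  -- Adjacency in the Bell graph through moved vertices

  Agree : Fin n → Part → Part → Set
  Agree v P Q = ∀ u w → u ≢ v → w ≢ v → at P u w ≡ at Q u w

  -- Over a nonempty vertex set this expresses distinctness and nonadjacency at once, since equal
  -- partitions agree away from every vertex.
  Apart : Part → Part → Set
  Apart P Q = ∀ v → ¬ Agree v P Q

  agree-sym : ∀ {v P Q} → Agree v P Q → Agree v Q P
  agree-sym h u w p q = ≡.sym (h u w p q)

  agree-trans : ∀ {v P Q R} → Agree v P Q → Agree v Q R → Agree v P R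
  agree-trans h k u w p q = trans (h u w p q) (k u w p q)

  agree⁺ : ∀ {v P Q} →
    (∀ {u w} → u ≢ v → w ≢ v → u ≢ w → P ∋ u ~ w → Q ∋ u ~ w) →
    (∀ {u w} → u ≢ v → w ≢ v → u ≢ w → Q ∋ u ~ w → P ∋ u ~ w) → Agree v P Q
  agree⁺ {P = P} {Q} f g u w p q with u ≟F w
  ... | yes refl = trans (~-refl P) (≡.sym (~-refl Q))
  ... | no r     = ≡-from-implications (f p q r) (g p q r)

  part-≡⁺ : ∀ {P Q} → (∀ {u w} → u ≢ w → P ∋ u ~ w → Q ∋ u ~ w) → (∀ {u w} → u ≢ w → Q ∋ u ~ w → P ∋ u ~ w) → P ≡ Q
  part-≡⁺ {P} {Q} f g = part-≡ same
    where
    same : ∀ u w → at P u w ≡ at Q u w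
    same u w with u ≟F w
    ... | yes refl = trans (~-refl P) (≡.sym (~-refl Q))
    ... | no r     = ≡-from-implications (f r) (g r)

  -- Away from v the result depends only on what P and K are away from v. Hence a move of v survives
  -- a further carving, and adding v to K or dropping it from K is a move of v.
  carve-agree : ∀ {v P Q K L i j} → Agree v P Q →
    (∀ {u} → u ≢ v → u ∈ K → u ∈ L) → (∀ {u} → u ≢ v → u ∈ L → u ∈ K) →
    Agree v (carve P K i) (carve Q L j)
  carve-agree {v} {P} {Q} {K} {L} {i} {j} h f g = agree⁺ fwd bwd
    where
    fwd : ∀ {u w} → u ≢ v → w ≢ v → u ≢ w → carve P K i ∋ u ~ w → carve Q L j ∋ u ~ w
    fwd {u} {w} p q _ r with carve-inv P K i r
    ... | inj₁ (a , b)     = carve-in Q L j (f p a) (f q b)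
    ... | inj₂ (a , b , c) = trans (carve-off Q L j (a ∘ g p) (b ∘ g q)) (trans (≡.sym (h u w p q)) c)
    bwd : ∀ {u w} → u ≢ v → w ≢ v → u ≢ w → carve Q L j ∋ u ~ w → carve P K i ∋ u ~ w
    bwd {u} {w} p q _ r with carve-inv Q L j r
    ... | inj₁ (a , b)     = carve-in P K i (g p a) (g q b)
    ... | inj₂ (a , b , c) = trans (carve-off P K i (a ∘ f p) (b ∘ f q)) (trans (h u w p q) c)

  carve-agree-self : ∀ {v P K i} → (∀ {u} → u ≢ v → u ∉ K) → Agree v P (carve P K i)
  carve-agree-self {P = P} {K} {i} h u w p q = ≡.sym (carve-off P K i (h p) (h q))

  isolate-agree : ∀ P x → Agree x P (isolate P x)
  isolate-agree P x = carve-agree-self λ p → ∉₁ p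

  Alone : Part → Fin n → Set
  Alone P a = ∀ {w} → P ∋ a ~ w → w ≡ a

  -- As a was alone, x is the only vertex that changes its block.
  merge-agree : ∀ P {x a} (c : Coadj x a) → Alone P a → Agree x P (merge P c)
  merge-agree P {x} {a} c alone = agree⁺ fwd bwd
    where
    fwd : ∀ {u w} → u ≢ x → w ≢ x → u ≢ w → P ∋ u ~ w → merge P c ∋ u ~ w
    fwd p q r h = trans (merge-off c p (λ { refl → r (≡.sym (alone h)) }) q (λ { refl → r (alone (~-sym P h)) })) h
    bwd : ∀ {u w} → u ≢ x → w ≢ x → u ≢ w → merge P c ∋ u ~ w → P ∋ u ~ w
    bwd p q r h with merge-inv c r h
    ... | inj₁ (inj₁ (e , _)) = contradiction e p
    ... | inj₁ (inj₂ (_ , e)) = contradiction e q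
    ... | inj₂ (_ , _ , _ , _ , k) = k

  infix 4 _∼_
  _∼_ : Part → Part → Set
  P ∼ Q = P ≢ Q × ∃ λ v → Agree v P Q

  opaque
    unfolding at

    ∼⇔Bell : ∀ {P Q} → P ∼ Q ⇔ E (Bell G) P Q
    ∼⇔Bell = mk⇔ id id

  ∼-sym : ∀ {P Q} → P ∼ Q → Q ∼ P
  ∼-sym {P} {Q} (P≢Q , v , h) = ≢-sym P≢Q , v , agree-sym h

  tf : ∀ {P Q u w} → P ∋ u ~ w → at Q u w ≡ false → at P u w ≢ at Q u w
  tf p q e = true≢false (trans (≡.sym e) p) q

  ft : ∀ {P Q u w} → at P u w ≡ false → Q ∋ u ~ w → at P u w ≢ at Q u w
  ft p q e = true≢false (trans e q) p

  ≢-by : ∀ {P Q u w} → at P u w ≢ at Q u w → P ≢ Q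
  ≢-by h refl = h refl

  edge : ∀ {P Q} v → Agree v P Q → ∀ {u w} → at P u w ≢ at Q u w → P ∼ Q
  edge {P} {Q} v h d = ≢-by {P} {Q} d , v , h

  agree-differ : ∀ {v P Q u w} → Agree v P Q → at P u w ≢ at Q u w → u ≡ v ⊎ w ≡ v
  agree-differ {v} {u = u} {w} h d with u ≟F v | w ≟F v
  ... | yes p | _     = inj₁ p
  ... | no _  | yes q = inj₂ q
  ... | no p  | no q  = contradiction (h u w p q) d

  -- If R is one move from P and one move from Q, the two movers form a vertex cover of the pairs on
  -- which P and Q differ. Common neighbours are excluded below by enumerating such covers.
  agree-cover : ∀ {v t P Q R u w} → Agree v P R → Agree t Q R → at P u w ≢ at Q u w →
                (u ≡ v ⊎ w ≡ v) ⊎ (u ≡ t ⊎ w ≡ t)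
  agree-cover {v} {t} {P} {Q} {R} {u} {w} h k d with at P u w ≟B at R u w
  ... | no e  = inj₁ (agree-differ h e)
  ... | yes e = inj₂ (agree-differ k λ e′ → d (trans e (≡.sym e′)))

  -- A mover would lie in both of two disjoint pairs.
  apart₂ : ∀ {P Q a b c d} → at P a b ≢ at Q a b → at P c d ≢ at Q c d →
           a ≢ c → a ≢ d → b ≢ c → b ≢ d → Apart P Q
  apart₂ {P} {Q} h k ac ad bc bd v g with agree-differ g h | agree-differ g k
  ... | inj₁ refl | inj₁ e = ac (≡.sym e)
  ... | inj₁ refl | inj₂ e = ad (≡.sym e)
  ... | inj₂ refl | inj₁ e = bc (≡.sym e)
  ... | inj₂ refl | inj₂ e = bd (≡.sym e)

  -- A triangle is the other minimal family of pairs without a common vertex.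
  apart₃ : ∀ {P Q a b c} → at P a b ≢ at Q a b → at P b c ≢ at Q b c → at P a c ≢ at Q a c →
           a ≢ b → b ≢ c → a ≢ c → Apart P Q
  apart₃ {P} {Q} h k l ab bc ac v g
    with agree-differ g h | agree-differ g k | agree-differ g l
  ... | inj₁ refl | inj₁ e | _ = ab (≡.sym e)
  ... | inj₁ refl | inj₂ e | _ = ac (≡.sym e)
  ... | inj₂ refl | _ | inj₁ e = ab e
  ... | inj₂ refl | _ | inj₂ e = bc (≡.sym e)

  differ-avoiding : ∀ {v P Q} → ¬ Agree v P Q → ∃₂ λ u w → u ≢ v × w ≢ v × at P u w ≢ at Q u w
  differ-avoiding {v} {P} {Q} h
    with any? (λ u → any? (λ w → ¬? (u ≟F v) ×-dec ¬? (w ≟F v) ×-dec ¬? (at P u w ≟B at Q u w)))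
  ... | yes (u , w , d) = u , w , d
  ... | no none = contradiction agree h
    where
    agree : Agree v P Q
    agree u w uv wv with at P u w ≟B at Q u w
    ... | yes e = e
    ... | no d  = contradiction (u , w , uv , wv , d) none

  ≢⇒differ : ∀ {P Q} → P ≢ Q → ∃₂ λ u w → at P u w ≢ at Q u w
  ≢⇒differ {P} {Q} h with any? (λ u → any? (λ w → ¬? (at P u w ≟B at Q u w)))
  ... | yes (u , w , d) = u , w , d
  ... | no none = contradiction (part-≡ λ u w → decide u w) h
    where
    decide : ∀ u w → at P u w ≡ at Q u w
    decide u w with at P u w ≟B at Q u w
    ... | yes e = e
    ... | no d  = contradiction (u , w , d) none

-- Partitions whose neighbourhood resembles that of the discrete partition

Far : (B : Graph) → V B → V B → Set
Far B c R = R ≢ c × ¬ E B c R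

-- For three distinct neighbours of the discrete partition such an R exists exactly if they are the
-- sides of a triangle; R then has the triangle as a block. This separates the triangle from the
-- star with three edges, which have the same line graph.
CommonFar : (B : Graph) → V B → V B → V B → V B → Set
CommonFar B c Q₁ Q₂ Q₃ = ∃ λ R → Far B c R × E B Q₁ R × E B Q₂ R × E B Q₃ R

-- At the discrete partition, where neighbours are edges of the complement, the fields read: two
-- disjoint edges have exactly one common far neighbour, with both as blocks; three edges with a
-- common far neighbour form a triangle and so meet pairwise; an edge that meets one side of a
-- triangle meets another side.
record LocallyDiscrete (B : Graph) (c : V B) : Set where
  field
    square : ∀ {Q Q′} → E B c Q → E B c Q′ → Q ≢ Q′ → ¬ E B Q Q′ →
             ∃ λ R → Far B c R × E B Q R × E B Q′ R
    square-unique : ∀ {Q Q′ R R′} → E B c Q → E B c Q′ → Q ≢ Q′ → ¬ E B Q Q′ →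
                    Far B c R → E B Q R → E B Q′ R → Far B c R′ → E B Q R′ → E B Q′ R′ → R ≡ R′
    pairwise : ∀ {Q₁ Q₂ Q₃} → E B c Q₁ → E B c Q₂ → E B c Q₃ → Q₁ ≢ Q₂ → Q₁ ≢ Q₃ → Q₂ ≢ Q₃ →
               CommonFar B c Q₁ Q₂ Q₃ → E B Q₁ Q₂
    corner : ∀ {Q₁ Q₂ Q₃ Q₄} → E B c Q₁ → E B c Q₂ → E B c Q₃ → Q₁ ≢ Q₂ → Q₁ ≢ Q₃ → Q₂ ≢ Q₃ →
             CommonFar B c Q₁ Q₂ Q₃ → E B c Q₄ → E B Q₁ Q₄ →
             (Q₄ ≡ Q₂ ⊎ E B Q₂ Q₄) ⊎ (Q₄ ≡ Q₃ ⊎ E B Q₃ Q₄)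

module Structure {n : ℕ} (G : SimpleGraph n) where

  open Partitions G

  𝓑 : Graph
  𝓑 = record { V = Part ; E = _∼_ }

  -- `no-exit` also bounds blocks by three elements, since a fourth would be an exit, and makes a
  -- block of three a component of the complement. By `pendant` the outer neighbours of a block of
  -- two are leaves.
  record Tame (P : Part) : Set where
    field
      no-exit : ∀ {x y z a} → x ≢ y → x ≢ z → y ≢ z → P ∋ x ~ y → P ∋ x ~ z → Coadj x a → a ≡ y ⊎ a ≡ z
      pendant : ∀ {x y a c} → x ≢ y → P ∋ x ~ y → ¬ P ∋ x ~ a → Coadj x a → Coadj a c → c ≡ x

  -- The vertex argument rules out the empty vertex set, where `Apart` holds vacuously, even between
  -- P and itself.
  apart⇒far : ∀ {P R} → Fin n → Apart P R → Far 𝓑 P R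
  apart⇒far v h = (λ { refl → h v λ _ _ _ _ → refl }) , λ { (_ , t , g) → h t g }

  far⇒apart : ∀ {P R} → Far 𝓑 P R → Apart P R
  far⇒apart (R≢P , h) v g = h (≢-sym R≢P , v , g)

  apart⇒≁ : ∀ {P R} → Apart P R → ¬ P ∼ R
  apart⇒≁ h (_ , v , g) = h v g

  drop₁ : ∀ {u a : Fin n} {K} → u ≢ a → u ∈ a ∷ K → u ∈ K
  drop₁ p (here e)  = contradiction e p
  drop₁ p (there q) = q

  drop₂ : ∀ {u a x : Fin n} → u ≢ x → u ∈ a ∷ x ∷ [] → u ∈ a ∷ []
  drop₂ p (here e)         = here e
  drop₂ p (there (here e)) = contradiction e p

  weaken : ∀ {u a x : Fin n} → u ∈ a ∷ [] → u ∈ a ∷ x ∷ []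
  weaken (here e) = here e

  false-sym : ∀ P {u w} → at P u w ≡ false → at P w u ≡ false
  false-sym P {u} {w} = trans (at-sym P w u)

  module _ (P : Part) (ld : LocallyDiscrete 𝓑 P) where

    open LocallyDiscrete ld

    -- Isolating a and isolating x commute, but merging a with x completes a second square.
    not-linked : ∀ {a b x y} → a ≢ b → x ≢ y → a ≢ x → a ≢ y → b ≢ x → b ≢ y →
                 P ∋ a ~ b → P ∋ x ~ y → ¬ Coadj a x
    not-linked {a} {b} {x} {y} ab xy ax ay bx by Pab Pxy c =
      true≢false (merge-in c) (trans (cong (λ S → at S a x) (≡.sym R≡R′)) (false-sym R (isolate-out ax)))
      where
      Qa = isolate P a
      Qx = isolate P x
      R  = isolate Qa x
      R′ = merge P c

      Qa-ab : at Qa a b ≡ false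
      Qa-ab = isolate-out (≢-sym ab)
      Qa-xy : Qa ∋ x ~ y
      Qa-xy = trans (isolate-off (≢-sym ax) (≢-sym ay)) Pxy
      Qx-ab : Qx ∋ a ~ b
      Qx-ab = trans (isolate-off ax bx) Pab
      Qx-xy : at Qx x y ≡ false
      Qx-xy = isolate-out (≢-sym xy)
      R-ab : at R a b ≡ false
      R-ab = trans (isolate-off ax bx) Qa-ab
      R-xy : at R x y ≡ false
      R-xy = isolate-out (≢-sym xy)
      R′-ab : at R′ a b ≡ false
      R′-ab = merge-out₁ c (≢-sym ab) bx
      R′-xy : at R′ x y ≡ false
      R′-xy = merge-out₂ c (≢-sym ay) (≢-sym xy)

      R≡R′ : R ≡ R′
      R≡R′ = square-unique
        (edge a (isolate-agree P a) (tf Pab Qa-ab))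
        (edge x (isolate-agree P x) (tf Pxy Qx-xy))
        (≢-by (ft Qa-ab Qx-ab))
        (apart⇒≁ (apart₂ (ft Qa-ab Qx-ab) (tf Qa-xy Qx-xy) ax ay bx by))
        (apart⇒far a (apart₂ (tf Pab R-ab) (tf Pxy R-xy) ax ay bx by))
        (edge x (isolate-agree Qa x) (tf Qa-xy R-xy))
        (edge a (carve-agree (isolate-agree P a) (λ _ → id) (λ _ → id)) (tf Qx-ab R-ab))
        (apart⇒far a (apart₂ (tf Pab R′-ab) (tf Pxy R′-xy) ax ay bx by))
        (edge x (carve-agree {P = P} (λ _ _ _ _ → refl) (λ _ → weaken) drop₂) (tf Qa-xy R′-xy))
        (edge a (carve-agree {P = P} (λ _ _ _ _ → refl) (λ _ → there) drop₁) (tf Qx-ab R′-ab))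

    -- A fourth element would yield two disjoint pairs in one block, with coadjacent ends, against
    -- `not-linked`.
    triple-class : ∀ {x y z w} → x ≢ y → x ≢ z → y ≢ z → P ∋ x ~ y → P ∋ x ~ z → P ∋ x ~ w →
                   w ≢ x → w ≢ y → w ≡ z
    triple-class {x} {y} {z} {w} xy xz yz Pxy Pxz Pxw wx wy with w ≟F z
    ... | yes e = e
    ... | no wz = contradiction (~-coadj P xz Pxz)
          (not-linked xy (≢-sym wz) xz (≢-sym wx) yz (≢-sym wy) Pxy (~-trans P (~-sym P Pxz) Pxw))

    neighbour-alone : ∀ {x y a} → x ≢ y → P ∋ x ~ y → ¬ P ∋ x ~ a → Coadj x a → Alone P a
    neighbour-alone {x} {y} {a} xy Pxy ¬Pxa c {w} Paw with w ≟F a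
    ... | yes e = e
    ... | no wa = contradiction c (not-linked xy (≢-sym wa) (proj₁ c)
            (λ { refl → ¬Pxa (~-sym P Paw) }) (λ { refl → ¬Pxa Pxy })
            (λ { refl → ¬Pxa (~-trans P Pxy (~-sym P Paw)) }) Pxy Paw)

    -- Isolating x, y or z gives three neighbours of P whose common far neighbour dissolves the
    -- block. Moving x to a gives a fourth neighbour, adjacent to `Qx` but neither equal nor
    -- adjacent to `Qy` or `Qz`, against `corner`.
    triple-closed : ∀ {x y z a} → x ≢ y → x ≢ z → y ≢ z → P ∋ x ~ y → P ∋ x ~ z → a ≢ y → a ≢ z → ¬ Coadj x a
    triple-closed {x} {y} {z} {a} xy xz yz Pxy Pxz ay az c
      = impossible (corner P∼Qx P∼Qy P∼Qz (≢-by (ft Qx-xz Qy-xz)) (≢-by (ft Qx-xy Qz-xy)) (≢-by (ft Qy-yx Qz-yx))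
             (R , far , Qx∼R , Qy∼R , Qz∼R) P∼Q Qx∼Q)
      where
      yx = ≢-sym xy
      zx = ≢-sym xz
      zy = ≢-sym yz
      ax = ≢-sym (proj₁ c)
      Pyz : P ∋ y ~ z
      Pyz = ~-trans P (~-sym P Pxy) Pxz
      ¬Pxa : ¬ P ∋ x ~ a
      ¬Pxa Pxa = az (triple-class xy xz yz Pxy Pxz Pxa ax ay)
      Pxa : at P x a ≡ false
      Pxa = ¬-not ¬Pxa
      Qx = isolate P x
      Qy = isolate P y
      Qz = isolate P z
      Q  = merge P c
      R  = isolate Qx y
      Qx-xy : at Qx x y ≡ false
      Qx-xy = isolate-out yx
      Qx-xz : at Qx x z ≡ false
      Qx-xz = isolate-out zx
      Qx-yz : Qx ∋ y ~ z
      Qx-yz = trans (isolate-off yx zx) Pyz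
      Qy-xz : Qy ∋ x ~ z
      Qy-xz = trans (isolate-off xy zy) Pxz
      Qy-yx : at Qy y x ≡ false
      Qy-yx = isolate-out xy
      Qz-xy : Qz ∋ x ~ y
      Qz-xy = trans (isolate-off xz yz) Pxy
      Qz-yx : Qz ∋ y ~ x
      Qz-yx = ~-sym Qz Qz-xy
      R-yz : at R y z ≡ false
      R-yz = isolate-out zy
      R-yx : at R y x ≡ false
      R-yx = isolate-out xy
      R-xz : at R x z ≡ false
      R-xz = trans (isolate-off xy zy) Qx-xz
      P∼Qx : P ∼ Qx
      P∼Qx = edge x (isolate-agree P x) (tf Pxy Qx-xy)
      P∼Qy : P ∼ Qy
      P∼Qy = edge y (isolate-agree P y) (tf (~-sym P Pxy) Qy-yx)
      P∼Qz : P ∼ Qz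
      P∼Qz = edge z (isolate-agree P z) (tf (~-sym P Pxz) (isolate-out xz))
      far : Far 𝓑 P R
      far = apart⇒far x (apart₃ (tf (~-sym P Pxy) R-yx) (tf Pxz R-xz) (tf Pyz R-yz) yx xz yz)
      Qx∼R : Qx ∼ R
      Qx∼R = edge y (isolate-agree Qx y) (tf Qx-yz R-yz)
      Qy∼R : Qy ∼ R
      Qy∼R = edge x (carve-agree (isolate-agree P x) (λ _ → id) (λ _ → id)) (tf Qy-xz R-xz)
      third : ∀ {u w} → u ≢ x → w ≢ x → u ≢ w → P ∋ u ~ w → (u ≡ y → w ≡ z) × (u ≡ z → w ≡ y)
      third ux wx uw Puw =
        (λ { refl → triple-class xy xz yz Pxy Pxz (~-trans P Pxy Puw) wx (≢-sym uw) }) ,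
        (λ { refl → triple-class xz xy zy Pxz Pxy (~-trans P Pxz Puw) wx (≢-sym uw) })
      -- Away from x the block is just the pair y, z, so isolating z there has the same effect as
      -- isolating y.
      Qz∼R : Qz ∼ R
      Qz∼R = edge x (agree⁺ fwd bwd) (tf Qz-yx R-yx)
        where
        fwd : ∀ {u w} → u ≢ x → w ≢ x → u ≢ w → Qz ∋ u ~ w → R ∋ u ~ w
        fwd ux wx uw h with isolate-inv uw h
        ... | uz , wz , Puw = trans
          (isolate-off (λ e → wz (proj₁ (third ux wx uw Puw) e))
                       (λ e → uz (proj₁ (third wx ux (≢-sym uw) (~-sym P Puw)) e)))
          (trans (isolate-off ux wx) Puw)
        bwd : ∀ {u w} → u ≢ x → w ≢ x → u ≢ w → R ∋ u ~ w → Qz ∋ u ~ w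
        bwd ux wx uw h with isolate-inv uw h
        ... | uy , wy , k with isolate-inv uw k
        ... | _ , _ , Puw = trans
          (isolate-off (λ e → wy (proj₂ (third ux wx uw Puw) e))
                       (λ e → uy (proj₂ (third wx ux (≢-sym uw) (~-sym P Puw)) e))) Puw
      P~Q : Agree x P Q
      P~Q = merge-agree P c (neighbour-alone xy Pxy ¬Pxa c)
      P∼Q : P ∼ Q
      P∼Q = edge x P~Q (ft Pxa (merge-in c))
      Qx∼Q : Qx ∼ Q
      Qx∼Q = edge x (agree-trans (agree-sym (isolate-agree P x)) P~Q) (ft (isolate-out ax) (merge-in c))
      Q-yz : Q ∋ y ~ z
      Q-yz = trans (merge-off c yx (≢-sym ay) zx (≢-sym az)) Pyz
      Q-zy : Q ∋ z ~ y
      Q-zy = ~-sym Q Q-yz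
      Qy-xa : at Qy x a ≡ false
      Qy-xa = trans (isolate-off xy ay) Pxa
      Qz-xa : at Qz x a ≡ false
      Qz-xa = trans (isolate-off xz az) Pxa
      impossible : (Q ≡ Qy ⊎ Qy ∼ Q) ⊎ (Q ≡ Qz ⊎ Qz ∼ Q) → ⊥
      impossible (inj₁ (inj₁ e)) = ≢-by (tf (merge-in c) Qy-xa) e
      impossible (inj₁ (inj₂ e)) =
        apart⇒≁ (apart₂ (ft Qy-xa (merge-in c)) (ft (isolate-out zy) Q-yz) xy xz ay az) e
      impossible (inj₂ (inj₁ e)) = ≢-by (tf (merge-in c) Qz-xa) e
      impossible (inj₂ (inj₂ e)) =
        apart⇒≁ (apart₂ (ft Qz-xa (merge-in c)) (ft (isolate-out yz) Q-zy) xz xy az ay) e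

    pair-class : ∀ {x y a} → x ≢ y → P ∋ x ~ y → ¬ P ∋ x ~ a → Coadj x a → ∀ {w} → P ∋ x ~ w → w ≢ x → w ≡ y
    pair-class {x} {y} {a} xy Pxy ¬Pxa c {w} Pxw wx with w ≟F y
    ... | yes e = e
    ... | no wy = contradiction c (triple-closed xy (≢-sym wx) (≢-sym wy) Pxy Pxw
                    (λ { refl → ¬Pxa Pxy }) (λ { refl → ¬Pxa Pxw }))

    -- A common neighbour of the partitions with axy and with a|x|y joins exactly two
    -- of a, x, y, and every partition of this kind is P itself or a neighbour of P.
    pair-no-apex : ∀ {x y a} → x ≢ y → P ∋ x ~ y → ¬ P ∋ x ~ a → Coadj x a → ¬ Coadj a y
    pair-no-apex {x} {y} {a} xy Pxy ¬Pxa cxa cay =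
      impossible (square P∼Q P∼S (≢-by dxy) (apart⇒≁ (apart₃ dax dxy day ax xy ay)))
      where
      yx = ≢-sym xy
      ax = ≢-sym (proj₁ cxa)
      xa = proj₁ cxa
      ay = proj₁ cay
      ya = ≢-sym ay
      alone : Alone P a
      alone = neighbour-alone xy Pxy ¬Pxa cxa
      class-x : ∀ {w} → P ∋ x ~ w → w ≢ x → w ≡ y
      class-x = pair-class xy Pxy ¬Pxa cxa
      class-y : ∀ {w} → P ∋ y ~ w → w ≢ y → w ≡ x
      class-y {w} Pyw wy with w ≟F x
      ... | yes e = e
      ... | no wx = contradiction (class-x (~-trans P Pxy Pyw) wx) wy
      K = a ∷ x ∷ y ∷ []
      K-indep : Indep K
      K-indep = triple-indep (coadj-sym cxa) cay (~-coadj P xy Pxy)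
      Q = carve P K K-indep
      S = isolate P x
      Q-in : ∀ {u w} → u ∈ K → w ∈ K → Q ∋ u ~ w
      Q-in = carve-in P K K-indep
      Q-off : ∀ {u w} → u ≢ a → u ≢ x → u ≢ y → w ≢ a → w ≢ x → w ≢ y → at Q u w ≡ at P u w
      Q-off p p′ p″ q q′ q″ = carve-off P K K-indep (∉₃ p p′ p″) (∉₃ q q′ q″)
      a∈K : a ∈ K
      a∈K = here refl
      x∈K : x ∈ K
      x∈K = there (here refl)
      y∈K : y ∈ K
      y∈K = there (there (here refl))
      S-x : ∀ {w} → w ≢ x → at S x w ≡ false
      S-x = isolate-out
      S-y : ∀ {w} → w ≢ y → at S y w ≡ false
      S-y {w} wy = ¬-not λ h → let _ , wx , Pyw = isolate-inv (≢-sym wy) h in wx (class-y Pyw wy)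
      dax : at Q a x ≢ at S a x
      dax = tf (Q-in a∈K x∈K) (false-sym S (S-x ax))
      dxy : at Q x y ≢ at S x y
      dxy = tf (Q-in x∈K y∈K) (S-x yx)
      day : at Q a y ≢ at S a y
      day = tf (Q-in a∈K y∈K) (false-sym S (S-y ay))
      P~Q : Agree a P Q
      P~Q = agree⁺ fwd bwd
        where
        fwd : ∀ {u w} → u ≢ a → w ≢ a → u ≢ w → P ∋ u ~ w → Q ∋ u ~ w
        fwd {u} {w} ua wa uw Puw with u ≟F x | u ≟F y | w ≟F x | w ≟F y
        ... | yes refl | _ | _ | _ = subst (λ w → Q ∋ x ~ w) (≡.sym (class-x Puw (≢-sym uw))) (Q-in x∈K y∈K)
        ... | _ | yes refl | _ | _ = subst (λ w → Q ∋ y ~ w) (≡.sym (class-y Puw (≢-sym uw))) (Q-in y∈K x∈K)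
        ... | no ux | no uy | yes refl | _ = contradiction (class-x (~-sym P Puw) uw) uy
        ... | no ux | no uy | _ | yes refl = contradiction (class-y (~-sym P Puw) uw) ux
        ... | no ux | no uy | no wx | no wy = trans (Q-off ua ux uy wa wx wy) Puw
        bwd : ∀ {u w} → u ≢ a → w ≢ a → u ≢ w → Q ∋ u ~ w → P ∋ u ~ w
        bwd ua wa uw h with carve-inv P K K-indep h
        ... | inj₂ (_ , _ , k) = k
        ... | inj₁ (here e , _) = contradiction e ua
        ... | inj₁ (_ , here e) = contradiction e wa
        ... | inj₁ (there (here refl) , there (here refl)) = contradiction refl uw
        ... | inj₁ (there (here refl) , there (there (here refl))) = Pxy
        ... | inj₁ (there (there (here refl)) , there (here refl)) = ~-sym P Pxy
        ... | inj₁ (there (there (here refl)) , there (there (here refl))) = contradiction refl uw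
      P∼Q : P ∼ Q
      P∼Q = edge a P~Q (ft (¬-not ¬Pxa) (Q-in x∈K a∈K))
      P∼S : P ∼ S
      P∼S = edge x (isolate-agree P x) (tf Pxy (S-x yx))
      -- The block of x is {x, y}, so isolating x isolates y as well and the move can be attributed
      -- to y.
      P~S-y : Agree y P S
      P~S-y = agree⁺
        (λ uy wy uw Puw → trans (isolate-off (λ { refl → wy (class-x Puw (≢-sym uw)) })
                                             (λ { refl → uy (class-x (~-sym P Puw) uw) })) Puw)
        (λ _ _ uw h → proj₂ (proj₂ (isolate-inv uw h)))

      -- If R arises from Q by moving x and from S by moving a, it joins a with y and leaves x
      -- alone. So R is P with y moved to a. The roles of x and y are left open because both orders
      -- occur.
      rotate : ∀ {x y R} → x ≢ y → a ≢ x → a ≢ y → (∀ {w} → P ∋ x ~ w → w ≢ x → w ≡ y) →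
               x ∈ K → y ∈ K → (∀ {u} → u ∈ K → u ≢ a → u ≢ x → u ≡ y) →
               (∀ {w} → w ≢ x → at S x w ≡ false) → Agree x Q R → Agree a S R → Agree y P R
      rotate {x} {y} {R} xy ax ay class-x x∈K y∈K K-only S-x h k = agree⁺ fwd bwd
        where
        R-xy : at R x y ≡ false
        R-xy = trans (≡.sym (k x y (≢-sym ax) (≢-sym ay))) (S-x (≢-sym xy))
        R-ay : R ∋ a ~ y
        R-ay = trans (≡.sym (h a y ax (≢-sym xy))) (Q-in a∈K y∈K)
        R-x : ∀ {w} → w ≢ x → ¬ R ∋ x ~ w
        R-x {w} wx Rxw with w ≟F a
        ... | yes refl = true≢false (~-trans R Rxw R-ay) R-xy
        ... | no wa    = true≢false Rxw (trans (≡.sym (k x w (≢-sym ax) wa)) (S-x wx))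
        outside : ∀ {u w} → u ≢ w → P ∋ u ~ w → u ≢ y → w ≢ y → u ∉ K
        outside {u} uw Puw uy wy u∈K with u ≟F a | u ≟F x
        ... | yes refl | _ = uw (≡.sym (alone Puw))
        ... | _ | yes refl = wy (class-x Puw (≢-sym uw))
        ... | no ua | no ux = uy (K-only u∈K ua ux)
        fwd : ∀ {u w} → u ≢ y → w ≢ y → u ≢ w → P ∋ u ~ w → R ∋ u ~ w
        fwd {u} {w} uy wy uw Puw =
          trans (≡.sym (h u w (λ { refl → u∉K x∈K }) (λ { refl → w∉K x∈K })))
                (trans (carve-off P K K-indep u∉K w∉K) Puw)
          where
          u∉K = outside uw Puw uy wy
          w∉K = outside (≢-sym uw) (~-sym P Puw) wy uy
        bwd : ∀ {u w} → u ≢ y → w ≢ y → u ≢ w → R ∋ u ~ w → P ∋ u ~ w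
        bwd {u} {w} uy wy uw Ruw with u ≟F x | w ≟F x
        ... | yes refl | _ = contradiction Ruw (R-x (≢-sym uw))
        ... | _ | yes refl = contradiction (~-sym R Ruw) (R-x uw)
        ... | no ux | no wx with carve-inv P K K-indep (trans (h u w ux wx) Ruw)
        ... | inj₂ (_ , _ , Puw) = Puw
        ... | inj₁ (u∈K , w∈K) with u ≟F a | w ≟F a
        ... | yes refl | yes refl = contradiction refl uw
        ... | no ua | _ = contradiction (K-only u∈K ua ux) uy
        ... | _ | no wa = contradiction (K-only w∈K wa wx) wy

      K-only-y : ∀ {u} → u ∈ K → u ≢ a → u ≢ x → u ≡ y
      K-only-y (here e) ua ux = contradiction e ua
      K-only-y (there (here e)) ua ux = contradiction e ux
      K-only-y (there (there (here e))) ua ux = e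
      K-only-x : ∀ {u} → u ∈ K → u ≢ a → u ≢ y → u ≡ x
      K-only-x (here e) ua uy = contradiction e ua
      K-only-x (there (here e)) ua uy = e
      K-only-x (there (there (here e))) ua uy = contradiction e uy

      impossible : (∃ λ R → Far 𝓑 P R × Q ∼ R × S ∼ R) → ⊥
      impossible (R , far , (_ , v , h) , (_ , t , k)) =
        -- The movers v and t cover the triangle on a, x, y. As v is not a, and t is neither x nor
        -- y, it follows that t is a and v is x or y; these are the two uses of `rotate`.
        cases (agree-cover h k dxy) (agree-cover h k day) (agree-cover h k dax)
        where
        apart : Apart P R
        apart = far⇒apart far
        va : v ≢ a
        va refl = apart a (agree-trans P~Q h)
        tx : t ≢ x
        tx refl = apart x (agree-trans (isolate-agree P x) k)
        ty : t ≢ y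
        ty refl = apart y (agree-trans P~S-y k)
        cases : (x ≡ v ⊎ y ≡ v) ⊎ (x ≡ t ⊎ y ≡ t) → (a ≡ v ⊎ y ≡ v) ⊎ (a ≡ t ⊎ y ≡ t) →
                (a ≡ v ⊎ x ≡ v) ⊎ (a ≡ t ⊎ x ≡ t) → ⊥
        cases (inj₂ (inj₁ e)) _ _ = tx (≡.sym e)
        cases (inj₂ (inj₂ e)) _ _ = ty (≡.sym e)
        cases _ (inj₁ (inj₁ e)) _ = va (≡.sym e)
        cases _ (inj₂ (inj₂ e)) _ = ty (≡.sym e)
        cases _ _ (inj₁ (inj₁ e)) = va (≡.sym e)
        cases _ _ (inj₂ (inj₂ e)) = tx (≡.sym e)
        cases (inj₁ (inj₁ refl)) (inj₁ (inj₂ e)) _ = xy (≡.sym e)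
        cases (inj₁ (inj₁ refl)) (inj₂ (inj₁ refl)) _ = apart y (rotate xy ax ay class-x x∈K y∈K K-only-y S-x h k)
        cases (inj₁ (inj₂ refl)) _ (inj₁ (inj₂ e)) = xy e
        cases (inj₁ (inj₂ refl)) _ (inj₂ (inj₁ refl)) = apart x (rotate yx ay ax class-y y∈K x∈K K-only-x S-y h k)

    -- Moving x to a and moving z to a give partitions that differ along the path y, x, a, z, w,
    -- whose only cover by two vertices is {x, z}. As a far R cannot be reached from P by moving x
    -- or z alone, R comes from the first by moving z and from the second by moving x. Then R joins
    -- x and z through a, against `not-linked`.
    pairs-no-common-neighbour : ∀ {x y z w a} → x ≢ y → z ≢ w → P ∋ x ~ y → P ∋ z ~ w → ¬ P ∋ x ~ z →
      ¬ P ∋ x ~ a → ¬ P ∋ z ~ a → Coadj x a → ¬ Coadj a z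
    pairs-no-common-neighbour {x} {y} {z} {w} {a} xy zw Pxy Pzw ¬Pxz ¬Pxa ¬Pza cxa caz =
      impossible (square P∼Q₁ P∼Q₂ (≢-by dxy) (apart⇒≁ (apart₂ dxy dzw xz xw yz yw)))
      where
      cza = coadj-sym caz
      xa = proj₁ cxa
      ax = ≢-sym xa
      az = proj₁ caz
      za = ≢-sym az
      xz : x ≢ z
      xz refl = ¬Pxz (~-refl P)
      xw : x ≢ w
      xw refl = ¬Pxz (~-sym P Pzw)
      yz : y ≢ z
      yz refl = ¬Pxz Pxy
      yw : y ≢ w
      yw refl = ¬Pxz (~-trans P Pxy (~-sym P Pzw))
      ya : y ≢ a
      ya refl = ¬Pxa Pxy
      wa : w ≢ a
      wa refl = ¬Pza Pzw
      alone : Alone P a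
      alone = neighbour-alone xy Pxy ¬Pxa cxa
      Q₁ = merge P cxa
      Q₂ = merge P cza
      P~Q₁ : Agree x P Q₁
      P~Q₁ = merge-agree P cxa alone
      P~Q₂ : Agree z P Q₂
      P~Q₂ = merge-agree P cza alone
      P∼Q₁ : P ∼ Q₁
      P∼Q₁ = edge x P~Q₁ (ft (¬-not ¬Pxa) (merge-in cxa))
      P∼Q₂ : P ∼ Q₂
      P∼Q₂ = edge z P~Q₂ (ft (¬-not ¬Pza) (merge-in cza))
      dxy : at Q₁ x y ≢ at Q₂ x y
      dxy = ft (merge-out₁ cxa (≢-sym xy) ya) (trans (merge-off cza xz xa yz ya) Pxy)
      dzw : at Q₁ z w ≢ at Q₂ z w
      dzw = tf (trans (merge-off cxa (≢-sym xz) za (≢-sym xw) wa) Pzw) (merge-out₁ cza (≢-sym zw) wa)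
      dax : at Q₁ a x ≢ at Q₂ a x
      dax = tf (~-sym Q₁ (merge-in cxa)) (merge-out₂ cza xz xa)
      daz : at Q₁ a z ≢ at Q₂ a z
      daz = ft (merge-out₂ cxa (≢-sym xz) za) (~-sym Q₂ (merge-in cza))
      impossible : (∃ λ R → Far 𝓑 P R × Q₁ ∼ R × Q₂ ∼ R) → ⊥
      impossible (R , far , (_ , v , h) , (_ , t , k)) =
        cases (agree-cover h k dxy) (agree-cover h k dzw) (agree-cover h k dax) (agree-cover h k daz)
        where
        vx : x ≢ v
        vx refl = far⇒apart far x (agree-trans P~Q₁ h)
        tz : z ≢ t
        tz refl = far⇒apart far z (agree-trans P~Q₂ k)
        crossed : v ≡ z → t ≡ x → ⊥
        crossed refl refl = not-linked xy zw xz xw yz yw Pxy Pzw (~-coadj R xz (~-trans R Rxa (~-sym R Rza)))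
          where
          Rxa : R ∋ x ~ a
          Rxa = trans (≡.sym (h x a xz az)) (merge-in cxa)
          Rza : R ∋ z ~ a
          Rza = trans (≡.sym (k z a (≢-sym xz) ax)) (merge-in cza)
        cases : (x ≡ v ⊎ y ≡ v) ⊎ (x ≡ t ⊎ y ≡ t) → (z ≡ v ⊎ w ≡ v) ⊎ (z ≡ t ⊎ w ≡ t) →
                (a ≡ v ⊎ x ≡ v) ⊎ (a ≡ t ⊎ x ≡ t) → (a ≡ v ⊎ z ≡ v) ⊎ (a ≡ t ⊎ z ≡ t) → ⊥
        cases (inj₁ (inj₁ e)) _ _ _ = vx e
        cases _ (inj₂ (inj₁ e)) _ _ = tz e
        cases _ _ (inj₁ (inj₂ e)) _ = vx e
        cases _ _ _ (inj₂ (inj₂ e)) = tz e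
        cases _ _ (inj₂ (inj₂ p)) (inj₁ (inj₂ q)) = crossed (≡.sym q) (≡.sym p)
        cases (inj₁ (inj₂ refl)) _ (inj₁ (inj₁ e)) _ = ya (≡.sym e)
        cases (inj₁ (inj₂ refl)) (inj₁ (inj₁ e)) _ _ = yz (≡.sym e)
        cases (inj₁ (inj₂ refl)) (inj₁ (inj₂ e)) _ _ = yw (≡.sym e)
        cases (inj₁ (inj₂ refl)) (inj₂ (inj₂ refl)) (inj₂ (inj₁ e)) _ = wa (≡.sym e)
        cases (inj₁ (inj₂ refl)) (inj₂ (inj₂ refl)) (inj₂ (inj₂ e)) _ = xw e
        cases (inj₂ (inj₁ refl)) (inj₁ (inj₁ e)) _ _ = crossed (≡.sym e) refl
        cases (inj₂ (inj₁ refl)) (inj₂ (inj₂ e)) _ _ = xw (≡.sym e)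
        cases (inj₂ (inj₁ refl)) (inj₁ (inj₂ refl)) _ (inj₁ (inj₁ e)) = wa (≡.sym e)
        cases (inj₂ (inj₁ refl)) (inj₁ (inj₂ refl)) _ (inj₁ (inj₂ e)) = zw e
        cases (inj₂ (inj₁ refl)) (inj₁ (inj₂ refl)) _ (inj₂ (inj₁ e)) = ax e
        cases (inj₂ (inj₂ refl)) (inj₂ (inj₂ e)) _ _ = yw (≡.sym e)
        cases (inj₂ (inj₂ refl)) _ (inj₂ (inj₁ e)) _ = ya (≡.sym e)
        cases (inj₂ (inj₂ refl)) _ (inj₂ (inj₂ e)) _ = xy e
        cases (inj₂ (inj₂ refl)) (inj₁ (inj₁ refl)) (inj₁ (inj₁ e)) _ = az e
        cases (inj₂ (inj₂ refl)) (inj₁ (inj₂ refl)) (inj₁ (inj₁ e)) _ = wa (≡.sym e)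

    -- Moving x to a, moving a to c and isolating x have a common far neighbour: x isolated and a
    -- with c. But the first two differ on the disjoint pairs xy and ac, so they are not adjacent,
    -- against `pairwise`.
    neighbour-no-mate : ∀ {x y a c} → x ≢ y → P ∋ x ~ y → ¬ P ∋ x ~ a → ¬ P ∋ x ~ c → Coadj x a → Alone P c → ¬ Coadj a c
    neighbour-no-mate {x} {y} {a} {c} xy Pxy ¬Pxa ¬Pxc cxa alone-c cac =
      apart⇒≁ (apart₂ dxy dac xa xc ya yc)
        (pairwise P∼Q₁ P∼Q₂ P∼S (≢-by dxy) (≢-by (tf (~-sym Q₁ (merge-in cxa)) S-ax)) (≢-by (tf Q₂-xy S-xy))
          (R , far , Q₁∼R , Q₂∼R , S∼R))
      where
      xa = proj₁ cxa
      ax = ≢-sym xa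
      ac = proj₁ cac
      ca = ≢-sym ac
      xc : x ≢ c
      xc refl = ¬Pxc (~-refl P)
      yc : y ≢ c
      yc refl = ¬Pxc Pxy
      ya : y ≢ a
      ya refl = ¬Pxa Pxy
      ¬Pac : ¬ P ∋ a ~ c
      ¬Pac h = ac (alone-c (~-sym P h))
      S  = isolate P x
      Q₁ = merge P cxa
      Q₂ = merge P cac
      R  = merge S cac
      S-xy : at S x y ≡ false
      S-xy = isolate-out (≢-sym xy)
      S-ax : at S a x ≡ false
      S-ax = false-sym S (isolate-out ax)
      S-ac : at S a c ≡ false
      S-ac = trans (isolate-off ax (≢-sym xc)) (¬-not ¬Pac)
      Q₂-xy : Q₂ ∋ x ~ y
      Q₂-xy = trans (merge-off cac xa xc ya yc) Pxy
      R-xy : at R x y ≡ false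
      R-xy = trans (merge-off cac xa xc ya yc) S-xy
      R-ax : at R a x ≡ false
      R-ax = merge-out₁ cac xa xc
      dxy : at Q₁ x y ≢ at Q₂ x y
      dxy = ft (merge-out₁ cxa (≢-sym xy) ya) Q₂-xy
      dac : at Q₁ a c ≢ at Q₂ a c
      dac = ft (merge-out₂ cxa (≢-sym xc) ca) (merge-in cac)
      S-alone : Alone S c
      S-alone {w} h with w ≟F c
      ... | yes e = e
      ... | no wc = alone-c (proj₂ (proj₂ (isolate-inv (≢-sym wc) h)))
      S~R : Agree a S R
      S~R = merge-agree S cac S-alone
      P∼S : P ∼ S
      P∼S = edge x (isolate-agree P x) (tf Pxy S-xy)
      P∼Q₁ : P ∼ Q₁
      P∼Q₁ = edge x (merge-agree P cxa (neighbour-alone xy Pxy ¬Pxa cxa)) (ft (¬-not ¬Pxa) (merge-in cxa))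
      P∼Q₂ : P ∼ Q₂
      P∼Q₂ = edge a (merge-agree P cac alone-c) (ft (¬-not ¬Pac) (merge-in cac))
      far : Far 𝓑 P R
      far = apart⇒far x (apart₂ (tf Pxy R-xy) (ft (¬-not ¬Pac) (merge-in cac)) xa xc ya yc)
      S∼R : S ∼ R
      S∼R = edge a S~R (ft S-ac (merge-in cac))
      Q₁∼R : Q₁ ∼ R
      Q₁∼R = edge a (agree-trans (carve-agree {P = P} (λ _ _ _ _ → refl) (λ p → drop₂ p) (λ _ → weaken)) S~R)
                    (tf (~-sym Q₁ (merge-in cxa)) R-ax)
      Q₂∼R : Q₂ ∼ R
      Q₂∼R = edge x (carve-agree (isolate-agree P x) (λ _ → id) (λ _ → id)) (tf Q₂-xy R-xy)

    tame : Tame P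
    tame = record { no-exit = no-exit ; pendant = pendant }
      where
      no-exit : ∀ {x y z a} → x ≢ y → x ≢ z → y ≢ z → P ∋ x ~ y → P ∋ x ~ z → Coadj x a → a ≡ y ⊎ a ≡ z
      no-exit {x} {y} {z} {a} xy xz yz Pxy Pxz c with a ≟F y | a ≟F z
      ... | yes e | _     = inj₁ e
      ... | no _  | yes e = inj₂ e
      ... | no ay | no az = contradiction c (triple-closed xy xz yz Pxy Pxz ay az)

      pendant : ∀ {x y a c} → x ≢ y → P ∋ x ~ y → ¬ P ∋ x ~ a → Coadj x a → Coadj a c → c ≡ x
      pendant {x} {y} {a} {c} xy Pxy ¬Pxa cxa cac with c ≟F x | c ≟F y | related? P x c
      ... | yes e | _        | _       = e
      ... | no _  | yes refl | _       = contradiction cac (pair-no-apex xy Pxy ¬Pxa cxa)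
      ... | no cx | no cy    | yes Pxc = contradiction (pair-class xy Pxy ¬Pxa cxa Pxc cx) cy
      ... | no cx | no cy    | no ¬Pxc with any? (λ w → ¬? (w ≟F c) ×-dec related? P c w)
      ... | yes (w , wc , Pcw) = contradiction cac (pairs-no-common-neighbour xy (≢-sym wc) Pxy Pcw ¬Pxc ¬Pxa
              (λ Pca → proj₁ cac (≡.sym (neighbour-alone xy Pxy ¬Pxa cxa (~-sym P Pca)))) cxa)
      ... | no none = contradiction cac (neighbour-no-mate xy Pxy ¬Pxa ¬Pxc cxa alone-c)
        where
        alone-c : Alone P c
        alone-c {w} h with w ≟F c
        ... | yes e = e
        ... | no wc = contradiction (w , wc , h) none

-- Labelling the neighbours of a partition by the edges of the complement

-- The interface between the Bell graph and Whitney's argument, used for both labellings of one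
-- neighbourhood. `triangle` and `star` use only the graph B to separate the two configurations that
-- adjacency of labels confuses.
record Model (B : Graph) (c : V B) (X : Set) : Set₁ where
  field
    Ends       : V B → X → X → Set
    ends-nbr   : ∀ {Q a b} → Ends Q a b → E B c Q
    ends-sym   : ∀ {Q a b} → Ends Q a b → Ends Q b a
    ends-≢     : ∀ {Q a b} → Ends Q a b → a ≢ b
    ends-exist : ∀ {Q} → E B c Q → ∃₂ (Ends Q)
    ends-det   : ∀ {Q Q′ a b} → Ends Q a b → Ends Q′ a b → Q ≡ Q′
    ends-uniq  : ∀ {Q a b d} → Ends Q a b → Ends Q a d → b ≡ d
    share      : ∀ {Q Q′ a b d} → Ends Q a b → Ends Q′ a d → Q ≢ Q′ → E B Q Q′
    meet       : ∀ {Q Q′ a b d e} → Ends Q a b → Ends Q′ d e → Q ≡ Q′ ⊎ E B Q Q′ →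
                 (a ≡ d ⊎ a ≡ e) ⊎ (b ≡ d ⊎ b ≡ e)
    triangle   : ∀ {Q₁ Q₂ Q₃ a b d} → Ends Q₁ a b → Ends Q₂ b d → Ends Q₃ d a → CommonFar B c Q₁ Q₂ Q₃
    star       : ∀ {Q₁ Q₂ Q₃ a b d e} → Ends Q₁ a b → Ends Q₂ a d → Ends Q₃ a e →
                 b ≢ d → b ≢ e → d ≢ e → ¬ CommonFar B c Q₁ Q₂ Q₃

module TameModel {n : ℕ} (G : SimpleGraph n) where

  open Partitions G
  open Structure G
  open DecMembership (_≟F_ {n}) using (_∈?_)

  module _ (P : Part) (tame : Tame P) where

    open Tame tame

    -- In Q the block {a , b} is new, or it was a block of P and Q splits it. So if P has a
    -- block of size three, isolating one of its elements is labelled by the other two.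
    record Ends (Q : Part) (a b : Fin n) : Set where
      field
        nbr  : P ∼ Q
        link : Coadj a b
        off  : ∀ {u w} → u ≢ a → u ≢ b → w ≢ a → w ≢ b → at Q u w ≡ at P u w
        out₁ : ∀ {u} → u ≢ a → u ≢ b → at Q a u ≡ false
        out₂ : ∀ {u} → u ≢ a → u ≢ b → at Q b u ≡ false
        joined : Q ∋ a ~ b ⊎ P ∋ a ~ b
    open Ends

    ends-≢ : ∀ {Q a b} → Ends Q a b → a ≢ b
    ends-≢ e = proj₁ (link e)

    ends-sym : ∀ {Q a b} → Ends Q a b → Ends Q b a
    ends-sym {Q} e = record
      { nbr = nbr e ; link = coadj-sym (link e) ; off = λ p q r s → off e q p s r
      ; out₁ = λ p q → out₂ e q p ; out₂ = λ p q → out₁ e q p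
      ; joined = [ inj₁ ∘ ~-sym Q , inj₂ ∘ ~-sym P ]′ (joined e) }

    ends-inv : ∀ {Q a b u w} → Ends Q a b → u ≢ w → Q ∋ u ~ w →
      (u ≡ a × w ≡ b ⊎ u ≡ b × w ≡ a) ⊎ (u ≢ a × u ≢ b × w ≢ a × w ≢ b × P ∋ u ~ w)
    ends-inv {Q} {a} {b} {u} {w} e uw h with u ≟F a | u ≟F b | w ≟F a | w ≟F b
    ... | yes refl | _ | _ | yes refl = inj₁ (inj₁ (refl , refl))
    ... | _ | yes refl | yes refl | _ = inj₁ (inj₂ (refl , refl))
    ... | yes refl | _ | yes refl | _ = contradiction refl uw
    ... | _ | yes refl | _ | yes refl = contradiction refl uw
    ... | yes refl | _ | no wa | no wb = contradiction (out₁ e wa wb) (true≢false h)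
    ... | _ | yes refl | no wa | no wb = contradiction (out₂ e wa wb) (true≢false h)
    ... | no ua | no ub | yes refl | _ = contradiction (out₁ e ua ub) (true≢false (~-sym Q h))
    ... | no ua | no ub | _ | yes refl = contradiction (out₂ e ua ub) (true≢false (~-sym Q h))
    ... | no ua | no ub | no wa | no wb = inj₂ (ua , ub , wa , wb , trans (≡.sym (off e ua ub wa wb)) h)

    ¬apart : ∀ {P Q} → P ∼ Q → ¬ Apart P Q
    ¬apart (_ , v , h) apart = apart v h

    -- If a is outside the block of b, it is pendant at b, which d contradicts. If a is inside, the
    -- block contains a, b, w, and d would be an exit unless it is w.
    two-links-class : ∀ {a b d w} → Coadj a b → Coadj a d → b ≢ d → P ∋ b ~ w → w ≢ a → w ≢ b → w ≡ d
    two-links-class {a} {b} {d} {w} ab ad bd Pbw wa wb with related? P b a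
    ... | no ¬Pba = contradiction (pendant (≢-sym wb) Pbw ¬Pba (coadj-sym ab) ad) (≢-sym bd)
    ... | yes Pba with no-exit (proj₁ ab) (≢-sym wa) (≢-sym wb) (~-sym P Pba) (~-trans P (~-sym P Pba) Pbw) ad
    ... | inj₁ e = contradiction (≡.sym e) bd
    ... | inj₂ e = ≡.sym e

    -- P and Q agree on ab and on all pairs that avoid a and b, so a pair on which they differ has
    -- one end in {a, b}. As Q does not join it, P does.
    third-member : ∀ {Q a b} → Ends Q a b → Q ∋ a ~ b → P ∋ a ~ b → ∃ λ p → p ≢ a × p ≢ b × P ∋ a ~ p
    third-member {Q} {a} {b} e Qab Pab with ≢⇒differ (proj₁ (nbr e))
    ... | u , w , d with u ≟F a | u ≟F b | w ≟F a | w ≟F b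
    ... | yes refl | _ | yes refl | _ = contradiction (trans (~-refl P) (≡.sym (~-refl Q))) d
    ... | _ | yes refl | _ | yes refl = contradiction (trans (~-refl P) (≡.sym (~-refl Q))) d
    ... | yes refl | _ | _ | yes refl = contradiction (trans Pab (≡.sym Qab)) d
    ... | _ | yes refl | yes refl | _ = contradiction (trans (~-sym P Pab) (≡.sym (~-sym Q Qab))) d
    ... | no ua | no ub | no wa | no wb = contradiction (≡.sym (off e ua ub wa wb)) d
    ... | yes refl | _ | no wa | no wb =
      w , wa , wb , ¬-not (λ f → d (trans f (≡.sym (out₁ e wa wb))))
    ... | no _ | yes refl | no wa | no wb =
      w , wa , wb , ~-trans P Pab (¬-not (λ f → d (trans f (≡.sym (out₂ e wa wb)))))
    ... | no ua | no ub | yes refl | _ =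
      u , ua , ub , ~-sym P (¬-not (λ f → d (trans f (≡.sym (false-sym Q (out₁ e ua ub))))))
    ... | no ua | no ub | no _ | yes refl =
      u , ua , ub , ~-trans P Pab (~-sym P (¬-not (λ f → d (trans f (≡.sym (false-sym Q (out₂ e ua ub)))))))

    witness : ∀ {Q a b} → Ends Q a b → ∃ λ p → at P a p ≢ at Q a p × (p ≡ b ⊎ p ≢ a × p ≢ b × P ∋ a ~ b × P ∋ a ~ p)
    witness {Q} {a} {b} e with at P a b ≟B at Q a b
    ... | no d = b , d , inj₁ refl
    ... | yes eq with both (joined e)
      where
      both : Q ∋ a ~ b ⊎ P ∋ a ~ b → Q ∋ a ~ b × P ∋ a ~ b
      both (inj₁ h) = h , trans eq h
      both (inj₂ h) = trans (≡.sym eq) h , h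
    ... | Qab , Pab with third-member e Qab Pab
    ... | p , pa , pb , Pap = p , tf Pap (out₁ e pa pb) , inj₂ (pa , pb , Pab , Pap)

    -- Each of Q and Q′ differs from P on a pair at its own label. A third block member occurring in
    -- such a pair is not an end of the other label, by `no-exit`, so the two pairs are disjoint and
    -- Q and Q′ differ on both.
    disjoint-apart : ∀ {Q Q′ a b d e} → Ends Q a b → Ends Q′ d e → a ≢ d → a ≢ e → b ≢ d → b ≢ e → Apart Q Q′
    disjoint-apart {Q} {Q′} {a} {b} {d} {e} h k ad ae bd be with witness h | witness k
    ... | p , dp , p-cases | q , dq , q-cases =
      apart₂ (λ eq → dp (trans (≡.sym (off k ad ae pd pe)) (≡.sym eq)))
             (λ eq → dq (trans (≡.sym (off h (≢-sym ad) (≢-sym bd) qa qb)) eq))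
             ad (≢-sym qa) pd (pq p-cases q-cases)
      where
      outside : ∀ {a b d e p} → Coadj d e → a ≢ b → a ≢ d → a ≢ e → b ≢ d → b ≢ e →
                p ≡ b ⊎ p ≢ a × p ≢ b × P ∋ a ~ b × P ∋ a ~ p → p ≢ d
      outside de ab ad ae bd be (inj₁ refl) = bd
      outside de ab ad ae bd be (inj₂ (pa , pb , Pab , Pap)) refl =
        [ ≢-sym ae , ≢-sym be ]′ (no-exit pa pb ab (~-sym P Pap) (~-trans P (~-sym P Pap) Pab) de)
      pd : p ≢ d
      pd = outside (link k) (ends-≢ h) ad ae bd be p-cases
      pe : p ≢ e
      pe = outside (coadj-sym (link k)) (ends-≢ h) ae ad be bd p-cases
      qa : q ≢ a
      qa = outside (link h) (ends-≢ k) (≢-sym ad) (≢-sym bd) (≢-sym ae) (≢-sym be) q-cases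
      qb : q ≢ b
      qb = outside (coadj-sym (link h)) (ends-≢ k) (≢-sym bd) (≢-sym ad) (≢-sym be) (≢-sym ae) q-cases
      pq : p ≡ b ⊎ p ≢ a × p ≢ b × P ∋ a ~ b × P ∋ a ~ p →
           q ≡ e ⊎ q ≢ d × q ≢ e × P ∋ d ~ e × P ∋ d ~ q → p ≢ q
      pq (inj₁ refl) _ = ≢-sym qb
      pq (inj₂ _) (inj₁ refl) = pe
      pq (inj₂ (pa , pb , Pab , Pap)) (inj₂ (_ , _ , _ , Pdq)) refl =
        [ ≢-sym bd , ≢-sym pd ]′ (no-exit (ends-≢ h) (≢-sym pa) (≢-sym pb) Pab Pap
          (~-coadj P ad (~-trans P Pap (~-sym P Pdq))))

    ends-det : ∀ {Q Q′ a b} → Ends Q a b → Ends Q′ a b → Q ≡ Q′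
    ends-det h k = part-≡⁺ (incl h k) (incl k h)
      where
      incl : ∀ {Q Q′ a b u w} → Ends Q a b → Ends Q′ a b → u ≢ w → Q ∋ u ~ w → Q′ ∋ u ~ w
      incl {Q} {Q′} {a} {b} h k uw Quw with ends-inv h uw Quw
      ... | inj₂ (ua , ub , wa , wb , Puw) = trans (off k ua ub wa wb) Puw
      ... | inj₁ same = [ (λ { (refl , refl) → Q′ab Quw }) , (λ { (refl , refl) → ~-sym Q′ (Q′ab (~-sym Q Quw)) }) ]′ same
        where
        Q′ab : Q ∋ a ~ b → Q′ ∋ a ~ b
        Q′ab Qab with related? Q′ a b | joined k
        ... | yes Q′ab | _        = Q′ab
        ... | no ¬Q′ab | inj₁ Q′ab = Q′ab
        -- Otherwise Q′ separates three elements of one block of P, which no single move does.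
        ... | no ¬Q′ab | inj₂ Pab with third-member h Qab Pab
        ... | p , pa , pb , Pap = contradiction
          (apart₃ (tf Pab (¬-not ¬Q′ab)) (tf (~-trans P (~-sym P Pab) Pap) (out₂ k pa pb)) (tf Pap (out₁ k pa pb))
            (ends-≢ h) (≢-sym pb) (≢-sym pa))
          (¬apart (nbr k))

    -- With two labels at a, Q would separate a, b and d although P has them in one block, which is
    -- more than a single move.
    ends-uniq : ∀ {Q a b d} → Ends Q a b → Ends Q a d → b ≡ d
    ends-uniq {Q} {a} {b} {d} h k with b ≟F d
    ... | yes e = e
    ... | no bd = contradiction
      (apart₃ (tf (only-P h Qab) Qab) (tf (~-trans P (~-sym P (only-P h Qab)) (only-P k Qad))
                  (out₂ h (≢-sym (ends-≢ k)) (≢-sym bd)))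
              (tf (only-P k Qad) Qad) (ends-≢ h) bd (ends-≢ k))
      (¬apart (nbr h))
      where
      Qab : at Q a b ≡ false
      Qab = out₁ k (≢-sym (ends-≢ h)) bd
      Qad : at Q a d ≡ false
      Qad = out₁ h (≢-sym (ends-≢ k)) (≢-sym bd)
      only-P : ∀ {a b} → Ends Q a b → at Q a b ≡ false → P ∋ a ~ b
      only-P h f = [ (λ t → contradiction f (true≢false t)) , id ]′ (joined h)

    -- The mover is a. Away from a the only danger is a pair of P at b or d that one of Q and Q′
    -- breaks; by `two-links-class` it would be the pair bd, which neither of them joins.
    share : ∀ {Q Q′ a b d} → Ends Q a b → Ends Q′ a d → Q ≢ Q′ → Q ∼ Q′
    share {Q} {Q′} {a} {b} {d} h k Q≢Q′ = Q≢Q′ , a , agree⁺ (incl h k bd) (incl k h (≢-sym bd))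
      where
      bd : b ≢ d
      bd refl = Q≢Q′ (ends-det h k)
      incl : ∀ {Q Q′ b d u w} → Ends Q a b → Ends Q′ a d → b ≢ d → u ≢ a → w ≢ a → u ≢ w → Q ∋ u ~ w → Q′ ∋ u ~ w
      incl {Q} {Q′} {b} {d} h k bd ua wa uw Quw with ends-inv h uw Quw
      ... | inj₁ (inj₁ (e , _)) = contradiction e ua
      ... | inj₁ (inj₂ (_ , e)) = contradiction e wa
      ... | inj₂ (_ , ub , _ , wb , Puw) = trans
        (off k ua (λ { refl → wb (two-links-class (link k) (link h) (≢-sym bd) Puw wa (≢-sym uw)) })
               wa (λ { refl → ub (two-links-class (link k) (link h) (≢-sym bd) (~-sym P Puw) ua uw) })) Puw

    meet : ∀ {Q Q′ a b d e} → Ends Q a b → Ends Q′ d e → Q ≡ Q′ ⊎ Q ∼ Q′ → (a ≡ d ⊎ a ≡ e) ⊎ (b ≡ d ⊎ b ≡ e)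
    meet {Q} {Q′} {a} {b} {d} {e} h k close with a ≟F d | a ≟F e | b ≟F d | b ≟F e
    ... | yes p | _ | _ | _ = inj₁ (inj₁ p)
    ... | _ | yes p | _ | _ = inj₁ (inj₂ p)
    ... | _ | _ | yes p | _ = inj₂ (inj₁ p)
    ... | _ | _ | _ | yes p = inj₂ (inj₂ p)
    ... | no ad | no ae | no bd | no be = contradiction close (not-close (disjoint-apart h k ad ae bd be))
      where
      not-close : Apart Q Q′ → ¬ (Q ≡ Q′ ⊎ Q ∼ Q′)
      not-close apart (inj₁ refl) = apart a (λ _ _ _ _ → refl)
      not-close apart (inj₂ adj)  = ¬apart adj apart

    -- Let x be the moved vertex. If x has a mate in Q, the two form the label. Otherwise x has left
    -- a block of P: of a pair, which is then the label, or of a triple, whose other two elements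
    -- are the label.
    ends-exist : ∀ {Q} → P ∼ Q → ∃₂ (Ends Q)
    ends-exist {Q} P∼Q@(P≢Q , x , h) with any? (λ w → ¬? (w ≟F x) ×-dec related? Q x w)
    ... | yes (w , wx , Qxw) = x , w , record
      { nbr = P∼Q ; link = cxw ; off = λ ux _ vx _ → ≡.sym (h _ _ ux vx)
      ; out₁ = λ ux uw → ¬-not (Q-out ux uw)
      ; out₂ = λ ux uw → ¬-not (λ Qwu → Q-out ux uw (~-trans Q Qxw Qwu))
      ; joined = inj₁ Qxw }
      where
      cxw : Coadj x w
      cxw = ~-coadj Q (≢-sym wx) Qxw
      Q⇒P : ∀ {u} → u ≢ x → Q ∋ x ~ u → P ∋ w ~ u
      Q⇒P ux Qxu = trans (h w _ wx ux) (~-trans Q (~-sym Q Qxw) Qxu)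
      ¬Pxw : ¬ P ∋ x ~ w
      ¬Pxw Pxw = P≢Q (part-≡⁺ P⇒Q′ Q⇒P′)
        where
        to-Q : ∀ {u} → u ≢ x → P ∋ x ~ u → Q ∋ x ~ u
        to-Q ux Pxu = ~-trans Q Qxw (trans (≡.sym (h w _ wx ux)) (~-trans P (~-sym P Pxw) Pxu))
        to-P : ∀ {u} → u ≢ x → Q ∋ x ~ u → P ∋ x ~ u
        to-P ux Qxu = ~-trans P Pxw (Q⇒P ux Qxu)
        P⇒Q′ : ∀ {u v} → u ≢ v → P ∋ u ~ v → Q ∋ u ~ v
        P⇒Q′ {u} {v} uv Puv with u ≟F x | v ≟F x
        ... | yes refl | _ = to-Q (≢-sym uv) Puv
        ... | _ | yes refl = ~-sym Q (to-Q uv (~-sym P Puv))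
        ... | no ux | no vx = trans (≡.sym (h u v ux vx)) Puv
        Q⇒P′ : ∀ {u v} → u ≢ v → Q ∋ u ~ v → P ∋ u ~ v
        Q⇒P′ {u} {v} uv Quv with u ≟F x | v ≟F x
        ... | yes refl | _ = to-P (≢-sym uv) Quv
        ... | _ | yes refl = ~-sym P (to-P uv (~-sym Q Quv))
        ... | no ux | no vx = trans (h u v ux vx) Quv
      -- A third element u would be a mate of w in P already. Then x is an outer neighbour of that
      -- block, hence pendant at w, but it is coadjacent to u too.
      Q-out : ∀ {u} → u ≢ x → u ≢ w → ¬ Q ∋ x ~ u
      Q-out ux uw Qxu = uw (pendant (≢-sym uw) (Q⇒P ux Qxu) (¬Pxw ∘ ~-sym P) (coadj-sym cxw) (~-coadj Q (≢-sym ux) Qxu))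
    ... | no none with any? (λ y → ¬? (y ≟F x) ×-dec related? P x y)
    ... | no none′ = contradiction (part-≡⁺ P⇒Q Q⇒P) P≢Q
      where
      P⇒Q : ∀ {u v} → u ≢ v → P ∋ u ~ v → Q ∋ u ~ v
      P⇒Q {u} {v} uv Puv with u ≟F x | v ≟F x
      ... | yes refl | _ = contradiction (v , ≢-sym uv , Puv) none′
      ... | _ | yes refl = contradiction (u , uv , ~-sym P Puv) none′
      ... | no ux | no vx = trans (≡.sym (h u v ux vx)) Puv
      Q⇒P : ∀ {u v} → u ≢ v → Q ∋ u ~ v → P ∋ u ~ v
      Q⇒P {u} {v} uv Quv with u ≟F x | v ≟F x
      ... | yes refl | _ = contradiction (v , ≢-sym uv , Quv) none
      ... | _ | yes refl = contradiction (u , uv , ~-sym Q Quv) none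
      ... | no ux | no vx = trans (h u v ux vx) Quv
    ... | yes (y , yx , Pxy) with any? (λ z → ¬? (z ≟F x) ×-dec ¬? (z ≟F y) ×-dec related? P x z)
    ... | no pair = x , y , record
      { nbr = P∼Q ; link = ~-coadj P (≢-sym yx) Pxy ; off = λ ux _ wx _ → ≡.sym (h _ _ ux wx)
      ; out₁ = λ {u} ux _ → ¬-not (λ Qxu → none (u , ux , Qxu))
      ; out₂ = λ {u} ux uy → ¬-not (λ Qyu → pair (u , ux , uy , ~-trans P Pxy (trans (h y u yx ux) Qyu)))
      ; joined = inj₂ Pxy }
    ... | yes (z , zx , zy , Pxz) = y , z , record
      { nbr = P∼Q ; link = ~-coadj P (≢-sym zy) Pyz ; off = off′
      ; out₁ = λ uy uz → ¬-not (Q-out (≢-sym yx) (≢-sym zx) yx (≢-sym zy) Pxy Pxz uy uz)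
      ; out₂ = λ uy uz → ¬-not (Q-out (≢-sym zx) (≢-sym yx) zx zy Pxz Pxy uz uy)
      ; joined = inj₂ Pyz }
      where
      Pyz : P ∋ y ~ z
      Pyz = ~-trans P (~-sym P Pxy) Pxz
      Q-out : ∀ {y z u} → x ≢ y → x ≢ z → y ≢ x → y ≢ z → P ∋ x ~ y → P ∋ x ~ z → u ≢ y → u ≢ z → ¬ Q ∋ y ~ u
      Q-out {y} {z} {u} xy xz yx yz Pxy Pxz uy uz Qyu with u ≟F x
      ... | yes refl = none (y , yx , ~-sym Q Qyu)
      ... | no ux = [ uy , uz ]′ (no-exit xy xz yz Pxy Pxz (~-coadj P (≢-sym ux) (~-trans P Pxy (trans (h y u yx ux) Qyu))))
      x-off : ∀ {w} → w ≢ y → w ≢ z → w ≢ x → at Q x w ≡ at P x w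
      x-off wy wz wx = trans (¬-not λ Qxw → none (_ , wx , Qxw))
        (≡.sym (¬-not λ Pxw → [ wy , wz ]′ (no-exit (≢-sym yx) (≢-sym zx) (≢-sym zy) Pxy Pxz (~-coadj P (≢-sym wx) Pxw))))
      off′ : ∀ {u w} → u ≢ y → u ≢ z → w ≢ y → w ≢ z → at Q u w ≡ at P u w
      off′ {u} {w} uy uz wy wz with u ≟F x | w ≟F x
      ... | yes refl | yes refl = trans (~-refl Q) (≡.sym (~-refl P))
      ... | yes refl | no wx    = x-off wy wz wx
      ... | no ux    | yes refl = trans (at-sym Q u x) (trans (x-off uy uz ux) (at-sym P x u))
      ... | no ux    | no wx    = ≡.sym (h u w ux wx)

    private
      -- β says whether K is contained in a block of P; the elements of K are then pairwise
      -- separated in R, and otherwise K is a block of R.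
      record Complementary (K : List (Fin n)) (β : Bool) (R : Part) : Set where
        field
          inside  : ∀ {u w} → u ∈ K → w ∈ K → u ≢ w → at R u w ≡ not β
          outside : ∀ {u w} → u ∉ K → w ∉ K → at R u w ≡ at P u w
          across  : ∀ {u w} → u ∈ K → w ∉ K → at R u w ≡ false

    -- P joins all three pairs or none (`spread`): if it joined just two vertices, the third would
    -- be an outer neighbour that is not pendant. R is P with this choice reversed.
    triangle : ∀ {Q₁ Q₂ Q₃ a b d} → Ends Q₁ a b → Ends Q₂ b d → Ends Q₃ d a → CommonFar 𝓑 P Q₁ Q₂ Q₃
    triangle {Q₁} {Q₂} {Q₃} {a} {b} {d} h₁ h₂ h₃ =
      R , far , Q∼R h₁ a∈K b∈K d∈K ad bd only-abd ,
      Q∼R h₂ b∈K d∈K a∈K (≢-sym ab) (≢-sym ad) only-bda ,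
      Q∼R h₃ d∈K a∈K b∈K (≢-sym bd) ab only-dab
      where
      ab = ends-≢ h₁
      bd = ends-≢ h₂
      ad = ≢-sym (ends-≢ h₃)
      cab = link h₁
      cbd = link h₂
      cad = coadj-sym (link h₃)
      K = a ∷ b ∷ d ∷ []
      a∈K : a ∈ K
      a∈K = here refl
      b∈K : b ∈ K
      b∈K = there (here refl)
      d∈K : d ∈ K
      d∈K = there (there (here refl))
      only-abd : ∀ {u} → u ∈ K → u ≢ a → u ≢ b → u ≡ d
      only-abd (here e) ua ub = contradiction e ua
      only-abd (there (here e)) ua ub = contradiction e ub
      only-abd (there (there (here e))) ua ub = e
      only-bda : ∀ {u} → u ∈ K → u ≢ b → u ≢ d → u ≡ a
      only-bda {u} u∈K ub ud with u ≟F a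
      ... | yes e = e
      ... | no ua = contradiction (only-abd u∈K ua ub) ud
      only-dab : ∀ {u} → u ∈ K → u ≢ d → u ≢ a → u ≡ b
      only-dab {u} u∈K ud ua with u ≟F b
      ... | yes e = e
      ... | no ub = contradiction (only-abd u∈K ua ub) ud

      spread : ∀ {a b d} → Coadj a b → Coadj a d → Coadj b d → P ∋ a ~ b → P ∋ a ~ d
      spread {a} {b} {d} ab ad bd Pab with related? P a d
      ... | yes Pad = Pad
      ... | no ¬Pad = contradiction (pendant (proj₁ ab) Pab ¬Pad ad (coadj-sym bd)) (≢-sym (proj₁ ab))
      β = at P a b
      P-ad : at P a d ≡ β
      P-ad = ≡-from-implications (spread cad cab (coadj-sym cbd)) (spread cab cad cbd)
      P-bd : at P b d ≡ β
      P-bd = ≡-from-implications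
        (λ h → ~-sym P (spread cbd (coadj-sym cab) (coadj-sym cad) h))
        (λ h → spread (coadj-sym cab) cbd cad (~-sym P h))
      P-inside : ∀ {u w} → u ∈ K → w ∈ K → u ≢ w → at P u w ≡ β
      P-inside (here refl) (here refl) uw = contradiction refl uw
      P-inside (here refl) (there (here refl)) uw = refl
      P-inside (here refl) (there (there (here refl))) uw = P-ad
      P-inside (there (here refl)) (here refl) uw = at-sym P b a
      P-inside (there (here refl)) (there (here refl)) uw = contradiction refl uw
      P-inside (there (here refl)) (there (there (here refl))) uw = P-bd
      P-inside (there (there (here refl))) (here refl) uw = trans (at-sym P d a) P-ad
      P-inside (there (there (here refl))) (there (here refl)) uw = trans (at-sym P d b) P-bd
      P-inside (there (there (here refl))) (there (there (here refl))) uw = contradiction refl uw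

      P-across : ∀ {u w} → u ∈ K → w ∉ K → ¬ P ∋ u ~ w
      P-across (here refl) w∉K Puw =
        w∉K (there (there (here (two-links-class (coadj-sym cab) cbd ad Puw (λ { refl → w∉K b∈K }) (λ { refl → w∉K a∈K })))))
      P-across (there (here refl)) w∉K Puw =
        w∉K (there (there (here (two-links-class cab cad bd Puw (λ { refl → w∉K a∈K }) (λ { refl → w∉K b∈K })))))
      P-across (there (there (here refl))) w∉K Puw =
        w∉K (there (here (two-links-class cad cab (≢-sym bd) Puw (λ { refl → w∉K a∈K }) (λ { refl → w∉K d∈K }))))

      K-indep : Indep K
      K-indep = triple-indep cab cad cbd

      complement : ∀ γ → β ≡ γ → ∃ (Complementary K γ)
      complement false _ = carve P K K-indep , record
        { inside = λ p q _ → carve-in P K K-indep p q ; outside = carve-off P K K-indep ; across = carve-out P K K-indep }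
      complement true _ = isolate (isolate (isolate P a) b) d , record { inside = ins ; outside = outs ; across = acr }
        where
        S = isolate (isolate (isolate P a) b) d
        unfold : ∀ {u w} → u ≢ w → S ∋ u ~ w → u ∉ K × P ∋ u ~ w
        unfold uw h with isolate-inv uw h
        ... | ud , _ , h′ with isolate-inv uw h′
        ... | ub , _ , h″ with isolate-inv uw h″
        ... | ua , _ , Puw = ∉₃ ua ub ud , Puw
        ins : ∀ {u w} → u ∈ K → w ∈ K → u ≢ w → at S u w ≡ false
        ins u∈K w∈K uw = ¬-not λ h → proj₁ (unfold uw h) u∈K
        outs : ∀ {u w} → u ∉ K → w ∉ K → at S u w ≡ at P u w
        outs {u} {w} p q = trans (isolate-off (λ { refl → p d∈K }) (λ { refl → q d∈K }))
          (trans (isolate-off (λ { refl → p b∈K }) (λ { refl → q b∈K }))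
                 (isolate-off (λ { refl → p a∈K }) (λ { refl → q a∈K })))
        acr : ∀ {u w} → u ∈ K → w ∉ K → at S u w ≡ false
        acr u∈K w∉K = ¬-not λ h → proj₁ (unfold (λ { refl → w∉K u∈K }) h) u∈K

      R : Part
      R = proj₁ (complement β refl)
      open Complementary (proj₂ (complement β refl))

      flipped : ∀ {u w} → u ∈ K → w ∈ K → u ≢ w → at P u w ≢ at R u w
      flipped p q uw e = not-¬ (P-inside p q uw) (trans e (inside p q uw))

      far : Far 𝓑 P R
      far = apart⇒far a (apart₃ (flipped a∈K b∈K ab) (flipped b∈K d∈K bd) (flipped a∈K d∈K ad) ab bd ad)

      Q∼R : ∀ {Q a b d} → Ends Q a b → a ∈ K → b ∈ K → d ∈ K → a ≢ d → b ≢ d →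
            (∀ {u} → u ∈ K → u ≢ a → u ≢ b → u ≡ d) → Q ∼ R
      Q∼R {Q} {a} {b} {d} h a∈K b∈K d∈K ad bd only = by-cases β refl
        where
        ab′ = ends-≢ h
        Qad : at Q a d ≡ false
        Qad = out₁ h (≢-sym ad) (≢-sym bd)
        Qbd : at Q b d ≡ false
        Qbd = out₂ h (≢-sym ad) (≢-sym bd)
        Qab : Q ∋ a ~ b
        Qab with related? Q a b | joined h
        ... | yes Qab | _        = Qab
        ... | no _    | inj₁ Qab = Qab
        ... | no ¬Qab | inj₂ Pab = contradiction
          (apart₃ (tf Pab (¬-not ¬Qab)) (tf (trans (P-inside b∈K d∈K bd) β-true) Qbd)
                  (tf (trans (P-inside a∈K d∈K ad) β-true) Qad) ab′ bd ad)
          (¬apart (nbr h))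
          where
          β-true : β ≡ true
          β-true = trans (≡.sym (P-inside a∈K b∈K ab′)) Pab
        K-split : ∀ {u w} → u ≢ w → R ∋ u ~ w → (u ∈ K × w ∈ K) ⊎ (u ∉ K × w ∉ K × P ∋ u ~ w)
        K-split {u} {w} uw Ruw with u ∈? K | w ∈? K
        ... | yes p | yes q = inj₁ (p , q)
        ... | yes p | no q  = contradiction (across p q) (true≢false Ruw)
        ... | no p  | yes q = contradiction (across q p) (true≢false (~-sym R Ruw))
        ... | no p  | no q  = inj₂ (p , q , trans (≡.sym (outside p q)) Ruw)
        off-R : ∀ {u w} → u ≢ a → u ≢ b → w ≢ a → w ≢ b → u ≢ w → P ∋ u ~ w → R ∋ u ~ w
        off-R {u} {w} ua ub wa wb uw Puw with u ∈? K | w ∈? K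
        ... | no p  | no q  = trans (outside p q) Puw
        ... | yes p | no q  = contradiction Puw (P-across p q)
        ... | no p  | yes q = contradiction (~-sym P Puw) (P-across q p)
        ... | yes p | yes q = contradiction (trans (only p ua ub) (≡.sym (only q wa wb))) uw
        R-off : ∀ {u w} → u ∉ K → w ∉ K → P ∋ u ~ w → Q ∋ u ~ w
        R-off p q Puw = trans (off h (λ { refl → p a∈K }) (λ { refl → p b∈K }) (λ { refl → q a∈K }) (λ { refl → q b∈K })) Puw
        -- Q has a and b together and d apart. One move of a dissolves K, and one move of d makes K
        -- a block.
        by-cases : ∀ γ → β ≡ γ → Q ∼ R
        by-cases true eq = edge a (agree⁺ fwd bwd) (tf Qab (trans (inside a∈K b∈K ab′) (cong not eq)))
          where
          fwd : ∀ {u w} → u ≢ a → w ≢ a → u ≢ w → Q ∋ u ~ w → R ∋ u ~ w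
          fwd ua wa uw Quw with ends-inv h uw Quw
          ... | inj₁ (inj₁ (e , _)) = contradiction e ua
          ... | inj₁ (inj₂ (_ , e)) = contradiction e wa
          ... | inj₂ (_ , ub , _ , wb , Puw) = off-R ua ub wa wb uw Puw
          bwd : ∀ {u w} → u ≢ a → w ≢ a → u ≢ w → R ∋ u ~ w → Q ∋ u ~ w
          bwd ua wa uw Ruw with K-split uw Ruw
          ... | inj₁ (p , q)       = contradiction (trans (inside p q uw) (cong not eq)) (true≢false Ruw)
          ... | inj₂ (p , q , Puw) = R-off p q Puw
        by-cases false eq = edge d (agree⁺ fwd bwd) (ft Qad (inside-true a∈K d∈K ad))
          where
          inside-true : ∀ {u w} → u ∈ K → w ∈ K → u ≢ w → R ∋ u ~ w
          inside-true p q uw = trans (inside p q uw) (cong not eq)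
          fwd : ∀ {u w} → u ≢ d → w ≢ d → u ≢ w → Q ∋ u ~ w → R ∋ u ~ w
          fwd ud wd uw Quw with ends-inv h uw Quw
          ... | inj₁ (inj₁ (refl , refl)) = inside-true a∈K b∈K uw
          ... | inj₁ (inj₂ (refl , refl)) = inside-true b∈K a∈K uw
          ... | inj₂ (ua , ub , wa , wb , Puw) = off-R ua ub wa wb uw Puw
          bwd : ∀ {u w} → u ≢ d → w ≢ d → u ≢ w → R ∋ u ~ w → Q ∋ u ~ w
          bwd {u} {w} ud wd uw Ruw with K-split uw Ruw
          ... | inj₂ (p , q , Puw) = R-off p q Puw
          ... | inj₁ (p , q) with u ≟F a | u ≟F b | w ≟F a | w ≟F b
          ... | yes refl | _ | _ | yes refl = Qab
          ... | _ | yes refl | yes refl | _ = ~-sym Q Qab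
          ... | yes refl | _ | yes refl | _ = contradiction refl uw
          ... | _ | yes refl | _ | yes refl = contradiction refl uw
          ... | no ua | no ub | _ | _ = contradiction (only p ua ub) ud
          ... | _ | _ | no wa | no wb = contradiction (only q wa wb) wd

    -- Each Q is P with a changed in position. A far R differs from P on some pair that avoids a,
    -- and the mover from each Q to R lies in this pair. So two of the three movers coincide, which
    -- `coincide` excludes.
    star : ∀ {Q₁ Q₂ Q₃ a b d e} → Ends Q₁ a b → Ends Q₂ a d → Ends Q₃ a e →
           b ≢ d → b ≢ e → d ≢ e → ¬ CommonFar 𝓑 P Q₁ Q₂ Q₃
    star {Q₁} {Q₂} {Q₃} {a} {b} {d} {e} h₁ h₂ h₃ bd be de
         (R , far , (_ , x₁ , g₁) , (_ , x₂ , g₂) , (_ , x₃ , g₃)) = located (differ-avoiding {a} (far⇒apart far a))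
      where
      -- By `two-links-class`, applied with d and with e, another mate of b would be equal to both.
      leaf : ∀ {b d e w} → Coadj a b → Coadj a d → Coadj a e → b ≢ d → b ≢ e → d ≢ e → P ∋ b ~ w → w ≢ a → w ≡ b
      leaf {b} {w = w} ab ad ae bd be de Pbw wa with w ≟F b
      ... | yes w≡b = w≡b
      ... | no wb = contradiction
              (trans (≡.sym (two-links-class ab ad bd Pbw wa wb)) (two-links-class ab ae be Pbw wa wb)) de

      agree-P : ∀ {Q b d e} → Ends Q a b → Coadj a d → Coadj a e → b ≢ d → b ≢ e → d ≢ e → Agree a P Q
      agree-P {Q} {b} h ad ae bd be de = agree⁺ fwd bwd
        where
        fwd : ∀ {u w} → u ≢ a → w ≢ a → u ≢ w → P ∋ u ~ w → Q ∋ u ~ w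
        fwd ua wa uw Puw = trans
          (off h ua (λ { refl → uw (≡.sym (leaf (link h) ad ae bd be de Puw wa)) })
                 wa (λ { refl → uw (leaf (link h) ad ae bd be de (~-sym P Puw) ua) })) Puw
        bwd : ∀ {u w} → u ≢ a → w ≢ a → u ≢ w → Q ∋ u ~ w → P ∋ u ~ w
        bwd ua wa uw Quw with ends-inv h uw Quw
        ... | inj₁ (inj₁ (eq , _)) = contradiction eq ua
        ... | inj₁ (inj₂ (_ , eq)) = contradiction eq wa
        ... | inj₂ (_ , _ , _ , _ , Puw) = Puw

      P~Q₁ : Agree a P Q₁
      P~Q₁ = agree-P h₁ (link h₂) (link h₃) bd be de
      P~Q₂ : Agree a P Q₂
      P~Q₂ = agree-P h₂ (link h₁) (link h₃) (≢-sym bd) de be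
      P~Q₃ : Agree a P Q₃
      P~Q₃ = agree-P h₃ (link h₁) (link h₂) (≢-sym be) (≢-sym de) bd

      record Arm (Q : Part) (b x : Fin n) : Set where
        constructor arm
        field
          ends : Ends Q a b
          P~Q  : Agree a P Q
          Q~R  : Agree x Q R
        x≢a : x ≢ a
        x≢a refl = far⇒apart far a (agree-trans P~Q Q~R)
      open Arm

      A₁ = arm h₁ P~Q₁ g₁
      A₂ = arm h₂ P~Q₂ g₂
      A₃ = arm h₃ P~Q₃ g₃

      -- The two would be equal: away from a both agree with P, and at a they agree on w by
      -- assumption and elsewhere because only w moves between them.
      not-same : ∀ {Q Q′ b b′ x x′ w} → Arm Q b x → Arm Q′ b′ x′ → Agree w Q Q′ → b ≢ b′ → w ≢ a →
                 at Q a w ≡ false → at Q′ a w ≡ false → ⊥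
      not-same {Q} {Q′} {w = w} A A′ g bb′ wa f f′ =
        bb′ (ends-uniq (ends A) (subst (λ Q → Ends Q a _) (≡.sym (part-≡ same)) (ends A′)))
        where
        same-a : ∀ v → v ≢ a → at Q a v ≡ at Q′ a v
        same-a v va with v ≟F w
        ... | yes refl = trans f (≡.sym f′)
        ... | no vw    = g a v (≢-sym wa) vw
        same : ∀ u v → at Q u v ≡ at Q′ u v
        same u v with u ≟F a | v ≟F a
        ... | yes refl | yes refl = trans (~-refl Q) (≡.sym (~-refl Q′))
        ... | yes refl | no va    = same-a v va
        ... | no ua    | yes refl = trans (at-sym Q u a) (trans (same-a u ua) (at-sym Q′ a u))
        ... | no ua    | no va    = trans (≡.sym (P~Q A u v ua va)) (P~Q A′ u v ua va)

      hit : ∀ {Q b x w} → Arm Q b x → w ≢ a → at Q a w ≢ at R a w → w ≡ x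
      hit A wa d with agree-differ (Q~R A) d
      ... | inj₁ refl = contradiction refl (x≢a A)
      ... | inj₂ eq   = eq

      -- If R joined a to w, two of the three arms would have an end other than w. Both would need w
      -- as mover, against `not-same`.
      R-alone : ∀ {w} → w ≢ a → at R a w ≡ false
      R-alone {w} wa = ¬-not cases
        where
        two-arms : ∀ {Q Q′ b b′ x x′} → Arm Q b x → Arm Q′ b′ x′ → b ≢ b′ → w ≢ b → w ≢ b′ → ¬ R ∋ a ~ w
        two-arms {Q} {Q′} A A′ bb′ wb wb′ Raw
          with hit A wa (ft (out₁ (ends A) wa wb) Raw) | hit A′ wa (ft (out₁ (ends A′) wa wb′) Raw)
        ... | refl | refl = not-same A A′ (agree-trans (Q~R A) (agree-sym (Q~R A′))) bb′ wa
                              (out₁ (ends A) wa wb) (out₁ (ends A′) wa wb′)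
        cases : ¬ R ∋ a ~ w
        cases with w ≟F b | w ≟F d
        ... | yes refl | _        = two-arms A₂ A₃ de bd be
        ... | no wb    | yes refl = two-arms A₁ A₃ be wb de
        ... | no wb    | no wd    = two-arms A₁ A₂ bd wb wd

      module _ {u w} (ua : u ≢ a) (wa : w ≢ a) (d : at P u w ≢ at R u w) where

        cuw : Coadj u w
        cuw with related? P u w
        ... | yes Puw = ~-coadj P uw Puw
          where
          uw : u ≢ w
          uw refl = d (trans (~-refl P) (≡.sym (~-refl R)))
        ... | no ¬Puw = ~-coadj R uw (¬-not λ Ruw → d (trans (¬-not ¬Puw) (≡.sym Ruw)))
          where
          uw : u ≢ w
          uw refl = d (trans (~-refl P) (≡.sym (~-refl R)))

        x-in : ∀ {Q b x} → Arm Q b x → u ≡ x ⊎ w ≡ x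
        x-in A = agree-differ (Q~R A) (λ eq → d (trans (P~Q A u w ua wa) eq))

        -- Q and Q′ agree away from b, so a is isolated in Q′ and P pairs a with b′; this makes a
        -- the only vertex that b can be joined to, whereas R and P differ on the pair b, b″.
        core : ∀ {Q Q′ Q″ b b′ b″ x″} → Arm Q b b → Arm Q′ b′ b → Arm Q″ b″ x″ →
               b ≢ b′ → b ≢ b″ → b′ ≢ b″ → ⊥
        core {Q} {Q′} {Q″} {b} {b′} {b″} A A′ A″ bb′ bb″ b′b″ =
          conclude (x-in A) (subst (λ x → u ≡ x ⊎ w ≡ x) (≡.sym (hit A″ b″a (tf Q″ab″ (R-alone b″a)))) (x-in A″))
          where
          ab = ends-≢ (ends A)
          ab′ = ends-≢ (ends A′)
          ab″ = ends-≢ (ends A″)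
          b″a = ≢-sym ab″
          ¬Q′ab′ : ¬ Q′ ∋ a ~ b′
          ¬Q′ab′ h = true≢false (trans (agree-trans (Q~R A) (agree-sym (Q~R A′)) a b′ ab (≢-sym bb′)) h)
                                (out₁ (ends A) (≢-sym ab′) (≢-sym bb′))
          Pab′ : P ∋ a ~ b′
          Pab′ = [ (λ h → contradiction h ¬Q′ab′) , id ]′ (joined (ends A′))
          ¬Pab : ¬ P ∋ a ~ b
          ¬Pab h = [ ≢-sym b′b″ , ≢-sym bb″ ]′ (no-exit ab′ ab (≢-sym bb′) Pab′ h (link (ends A″)))
          ¬Pab″ : ¬ P ∋ a ~ b″
          ¬Pab″ h = [ bb′ , bb″ ]′ (no-exit ab′ ab″ b′b″ Pab′ h (link (ends A)))
          Q″ab″ : Q″ ∋ a ~ b″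
          Q″ab″ = [ id , (λ h → contradiction h ¬Pab″) ]′ (joined (ends A″))
          lonely : ∀ {c} → Coadj b c → c ≡ a
          lonely c = pendant ab′ Pab′ ¬Pab (link (ends A)) c
          conclude : u ≡ b ⊎ w ≡ b → u ≡ b″ ⊎ w ≡ b″ → ⊥
          conclude (inj₁ refl) (inj₁ eq) = bb″ eq
          conclude (inj₁ refl) (inj₂ refl) = b″a (lonely cuw)
          conclude (inj₂ refl) (inj₁ refl) = b″a (lonely (coadj-sym cuw))
          conclude (inj₂ refl) (inj₂ eq) = bb″ eq

        joins-end : ∀ {Q b x} → Arm Q b x → Q ∋ a ~ x → x ≡ b
        joins-end {b = b} {x} A h with x ≟F b
        ... | yes e = e
        ... | no xb = contradiction (out₁ (ends A) (x≢a A) xb) (true≢false h)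

        coincide : ∀ {Q Q′ Q″ b b′ b″ t x″} → Arm Q b t → Arm Q′ b′ t → Arm Q″ b″ x″ →
                   b ≢ b′ → b ≢ b″ → b′ ≢ b″ → ⊥
        coincide {Q} {Q′} {t = t} A A′ A″ bb′ bb″ b′b″ with related? Q a t | related? Q′ a t
        ... | no h  | no h′ = not-same A A′ (agree-trans (Q~R A) (agree-sym (Q~R A′))) bb′ (x≢a A) (¬-not h) (¬-not h′)
        ... | yes h | _ with refl ← joins-end A h = core A A′ A″ bb′ bb″ b′b″
        ... | no _ | yes h with refl ← joins-end A′ h = core A′ A A″ (≢-sym bb′) b′b″ bb″

        two-coincide : u ≡ x₁ ⊎ w ≡ x₁ → u ≡ x₂ ⊎ w ≡ x₂ → u ≡ x₃ ⊎ w ≡ x₃ → ⊥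
        two-coincide (inj₁ refl) (inj₁ refl) _ = coincide A₁ A₂ A₃ bd be de
        two-coincide (inj₂ refl) (inj₂ refl) _ = coincide A₁ A₂ A₃ bd be de
        two-coincide (inj₁ refl) _ (inj₁ refl) = coincide A₁ A₃ A₂ be bd (≢-sym de)
        two-coincide (inj₂ refl) _ (inj₂ refl) = coincide A₁ A₃ A₂ be bd (≢-sym de)
        two-coincide _ (inj₁ refl) (inj₁ refl) = coincide A₂ A₃ A₁ de (≢-sym bd) (≢-sym be)
        two-coincide _ (inj₂ refl) (inj₂ refl) = coincide A₂ A₃ A₁ de (≢-sym bd) (≢-sym be)

      located : (∃₂ λ u w → u ≢ a × w ≢ a × at P u w ≢ at R u w) → ⊥
      located (_ , _ , ua , wa , d) = two-coincide ua wa d (x-in ua wa d A₁) (x-in ua wa d A₂) (x-in ua wa d A₃)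

    model : Model 𝓑 P (Fin n)
    model = record
      { Ends = Ends ; ends-nbr = nbr ; ends-sym = ends-sym ; ends-≢ = ends-≢ ; ends-exist = ends-exist
      ; ends-det = ends-det ; ends-uniq = ends-uniq ; share = share ; meet = meet ; triangle = triangle ; star = star }

module Incidence {B : Graph} {c : V B} {n : ℕ} (M : Model B c (Fin n)) where

  open Model M public

  Inc : V B → Fin n → Set
  Inc Q a = ∃ λ b → Ends Q a b

  inc₁ : ∀ {Q a b} → Ends Q a b → Inc Q a
  inc₁ e = _ , e

  inc₂ : ∀ {Q a b} → Ends Q a b → Inc Q b
  inc₂ e = _ , ends-sym e

  -- `meet` applied to Q and itself says that any two labels of Q have an end in common.
  inc-pair : ∀ {Q a b} → a ≢ b → Inc Q a → Inc Q b → Ends Q a b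
  inc-pair ab (x , e) (y , f) with meet e f (inj₁ refl)
  ... | inj₁ (inj₁ a≡b)  = contradiction a≡b ab
  ... | inj₁ (inj₂ refl) = ends-sym f
  ... | inj₂ (inj₁ refl) = e
  ... | inj₂ (inj₂ refl) = contradiction (ends-uniq (ends-sym e) (ends-sym f)) ab

  inc-either : ∀ {Q a b v} → Ends Q a b → Inc Q v → v ≡ a ⊎ v ≡ b
  inc-either {a = a} {v = v} e i with v ≟F a
  ... | yes v≡a = inj₁ v≡a
  ... | no v≢a  = inj₂ (ends-uniq (inc-pair (≢-sym v≢a) (inc₁ e) i) e)

  share-inc : ∀ {Q Q′ v} → Inc Q v → Inc Q′ v → Q ≡ Q′ ⊎ E B Q Q′
  share-inc (x , e) (y , f) with x ≟F y
  ... | yes refl = inj₁ (ends-det e f)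
  ... | no x≢y   = inj₂ (share e f λ { refl → x≢y (ends-uniq e f) })

  meets : ∀ {Q Q′ a b} → E B c Q → Ends Q′ a b → E B Q Q′ → Inc Q a ⊎ Inc Q b
  meets nbr f adj with ends-exist nbr
  ... | x , y , e with meet e f (inj₂ adj)
  ... | inj₁ (inj₁ refl) = inj₁ (inc₁ e)
  ... | inj₁ (inj₂ refl) = inj₂ (inc₁ e)
  ... | inj₂ (inj₁ refl) = inj₁ (inc₂ e)
  ... | inj₂ (inj₂ refl) = inj₂ (inc₂ e)

-- The neighbourhood of the discrete partition

module Discrete {n : ℕ} (G : SimpleGraph n) where

  open Partitions G
  open Structure G

  private
    module T = TameModel G

  discrete-tame : Tame discrete
  discrete-tame = record
    { no-exit = λ xy _ _ h _ _ → contradiction (discrete-~ h) xy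
    ; pendant = λ xy h _ _ _ → contradiction (discrete-~ h) xy }

  discrete-model : Model 𝓑 discrete (Fin n)
  discrete-model = T.model discrete discrete-tame

  open Incidence discrete-model

  discrete-≁ : ∀ {u w} → u ≢ w → at discrete u w ≡ false
  discrete-≁ uw = ¬-not (uw ∘ discrete-~)

  merge-ends : ∀ {a b} (c : Coadj a b) → Ends (merge discrete c) a b
  merge-ends {a} {b} c = record
    { nbr = edge a (merge-agree discrete c (≡.sym ∘ discrete-~)) (ft (discrete-≁ (proj₁ c)) (merge-in c))
    ; link = c ; off = merge-off c ; out₁ = merge-out₁ c ; out₂ = merge-out₂ c ; joined = inj₁ (merge-in c) }

  private
    joined′ : ∀ {Q a b} → Ends Q a b → Q ∋ a ~ b
    joined′ e = [ id , (λ h → contradiction (discrete-~ h) (ends-≢ e)) ]′ (T.Ends.joined e)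

    inv : ∀ {Q a b u w} → Ends Q a b → u ≢ w → Q ∋ u ~ w → u ≡ a × w ≡ b ⊎ u ≡ b × w ≡ a
    inv e uw h with T.ends-inv discrete discrete-tame e uw h
    ... | inj₁ cases = cases
    ... | inj₂ (_ , _ , _ , _ , d) = contradiction (discrete-~ d) uw

    agree-a : ∀ {Q a b} → Ends Q a b → Agree a discrete Q
    agree-a e = agree⁺ (λ _ _ uw h → contradiction (discrete-~ h) uw) bwd
      where
      bwd : ∀ {u w} → u ≢ _ → w ≢ _ → u ≢ w → _ ∋ u ~ w → discrete ∋ u ~ w
      bwd ua wa uw h with inv e uw h
      ... | inj₁ (refl , _) = contradiction refl ua
      ... | inj₂ (_ , refl) = contradiction refl wa

    -- Q is discrete away from either of its ends, so moving an end cannot lead to a far partition.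
    mover-∉ : ∀ {Q R x v} → Far 𝓑 discrete R → Agree x Q R → Inc Q v → v ≢ x
    mover-∉ far g (_ , e) refl = far⇒apart far _ (agree-trans (agree-a e) g)

    contains : ∀ {Q R x a b} → Far 𝓑 discrete R → Agree x Q R → Ends Q a b → R ∋ a ~ b
    contains far g e =
      trans (≡.sym (g _ _ (mover-∉ far g (inc₁ e)) (mover-∉ far g (inc₂ e)))) (joined′ e)

    -- R joins the ends of Q′ by `contains`. If x were not among them, Q would join them too, since
    -- it agrees with R away from x, and would equal Q′.
    mover-∈ : ∀ {Q Q′ R x} → Far 𝓑 discrete R → Agree x Q R → Q′ ∼ R →
              discrete ∼ Q → discrete ∼ Q′ → Q ≢ Q′ → Inc Q′ x
    mover-∈ {Q} {Q′} {R} {x} far g (_ , y , g′) nbr nbr′ Q≢Q′ with ends-exist nbr | ends-exist nbr′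
    ... | a , b , e | d , f , e′ with d ≟F x | f ≟F x
    ... | yes refl | _        = inc₁ e′
    ... | no _     | yes refl = inc₂ e′
    ... | no dx    | no fx with inv e (ends-≢ e′) (trans (g d f dx fx) (contains far g′ e′))
    ... | inj₁ (refl , refl) = contradiction (ends-det e e′) Q≢Q′
    ... | inj₂ (refl , refl) = contradiction (ends-det e (ends-sym e′)) Q≢Q′

  discrete-locally-discrete : LocallyDiscrete 𝓑 discrete
  discrete-locally-discrete = record
    { square = square ; square-unique = square-unique ; pairwise = pairwise ; corner = corner }
    where
    no-common : ∀ {Q Q′ u w} → Q ≢ Q′ → ¬ Q ∼ Q′ → Inc Q u → Inc Q′ w → u ≢ w
    no-common Q≢Q′ ¬adj i i′ refl = [ Q≢Q′ , ¬adj ]′ (share-inc i i′)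

    square : ∀ {Q Q′} → discrete ∼ Q → discrete ∼ Q′ → Q ≢ Q′ → ¬ Q ∼ Q′ →
             ∃ λ R → Far 𝓑 discrete R × Q ∼ R × Q′ ∼ R
    square {Q} {Q′} nbr nbr′ Q≢Q′ ¬adj with ends-exist nbr | ends-exist nbr′
    ... | a , b , e | d , f , e′ = merge Q c , far , Q∼R , Q′∼R
      where
      apart : ∀ {u w} → Inc Q u → Inc Q′ w → u ≢ w
      apart = no-common Q≢Q′ ¬adj
      ad = apart (inc₁ e) (inc₁ e′)
      af = apart (inc₁ e) (inc₂ e′)
      bd = apart (inc₂ e) (inc₁ e′)
      bf = apart (inc₂ e) (inc₂ e′)
      c : Coadj d f
      c = T.Ends.link e′
      R-ab : merge Q c ∋ a ~ b
      R-ab = trans (merge-off c ad af bd bf) (joined′ e)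
      far : Far 𝓑 discrete (merge Q c)
      far = apart⇒far a (apart₂ (ft (discrete-≁ (ends-≢ e)) R-ab) (ft (discrete-≁ (ends-≢ e′)) (merge-in c)) ad af bd bf)
      alone : Alone Q f
      alone {w} h with w ≟F f
      ... | yes eq = eq
      ... | no wf with inv e (≢-sym wf) h
      ... | inj₁ (refl , _) = contradiction refl af
      ... | inj₂ (refl , _) = contradiction refl bf
      Q-df : ¬ Q ∋ d ~ f
      Q-df h = ends-≢ e′ (alone (~-sym Q h))
      Q∼R : Q ∼ merge Q c
      Q∼R = edge d (merge-agree Q c alone) (ft (¬-not Q-df) (merge-in c))
      Q′-ab : ¬ Q′ ∋ a ~ b
      Q′-ab h with inv e′ (ends-≢ e) h
      ... | inj₁ (refl , _) = ad refl
      ... | inj₂ (refl , _) = af refl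
      Q′∼R : Q′ ∼ merge Q c
      Q′∼R = edge a (agree⁺ fwd bwd) (ft (¬-not Q′-ab) R-ab)
        where
        fwd : ∀ {u w} → u ≢ a → w ≢ a → u ≢ w → Q′ ∋ u ~ w → merge Q c ∋ u ~ w
        fwd ua wa uw h with inv e′ uw h
        ... | inj₁ (refl , refl) = merge-in c
        ... | inj₂ (refl , refl) = ~-sym (merge Q c) (merge-in c)
        bwd : ∀ {u w} → u ≢ a → w ≢ a → u ≢ w → merge Q c ∋ u ~ w → Q′ ∋ u ~ w
        bwd ua wa uw h with merge-inv c uw h
        ... | inj₁ (inj₁ (refl , refl)) = joined′ e′
        ... | inj₁ (inj₂ (refl , refl)) = ~-sym Q′ (joined′ e′)
        ... | inj₂ (_ , _ , _ , _ , k) with inv e uw k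
        ... | inj₁ (refl , _) = contradiction refl ua
        ... | inj₂ (_ , refl) = contradiction refl wa

    square-unique : ∀ {Q Q′ R R′} → discrete ∼ Q → discrete ∼ Q′ → Q ≢ Q′ → ¬ Q ∼ Q′ →
                    Far 𝓑 discrete R → Q ∼ R → Q′ ∼ R → Far 𝓑 discrete R′ → Q ∼ R′ → Q′ ∼ R′ → R ≡ R′
    square-unique {Q} {Q′} nbr nbr′ Q≢Q′ ¬adj far q q′ far′ r r′ =
      part-≡⁺ (incl far q q′ far′ r r′) (incl far′ r r′ far q q′)
      where
      transfer : ∀ {Q R u w} → discrete ∼ Q → Far 𝓑 discrete R → Q ∼ R → u ≢ w → Q ∋ u ~ w → R ∋ u ~ w
      transfer {R = R} nbr far (_ , _ , g) uw h with ends-exist nbr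
      ... | _ , _ , e with inv e uw h
      ... | inj₁ (refl , refl) = contains far g e
      ... | inj₂ (refl , refl) = ~-sym R (contains far g e)

      -- The mover x from Q to R lies in Q′, and the mover y from Q′ to R lies in Q. A pair of R
      -- that avoids x belongs to Q and one that avoids y to Q′; both are joined in R′. The pair xy
      -- is left: if R joined it, R and hence Q would join the other ends y′ and x′ of the two
      -- edges.
      incl : ∀ {R R′ u w} → Far 𝓑 discrete R → Q ∼ R → Q′ ∼ R → Far 𝓑 discrete R′ → Q ∼ R′ → Q′ ∼ R′ →
             u ≢ w → R ∋ u ~ w → R′ ∋ u ~ w
      incl {R} {R′} {u} {w} far q@(_ , x , g) q′@(_ , y , g′) far′ r r′ uw Ruw
        with mover-∈ far g q′ nbr nbr′ Q≢Q′ | mover-∈ far g′ q nbr′ nbr (≢-sym Q≢Q′)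
      ... | x′ , e′ | y′ , e = choose (u ≟F x) (w ≟F x) (u ≟F y) (w ≟F y)
        where
        R-xy : ¬ R ∋ x ~ y
        R-xy h with inv e y′≢x′ (trans (g y′ x′ (mover-∉ far g (inc₂ e)) (≢-sym (ends-≢ e′)))
                      (~-trans R (~-sym R (contains far g e)) (~-trans R (~-sym R h) (contains far g′ e′))))
          where
          y′≢x′ : y′ ≢ x′
          y′≢x′ = no-common Q≢Q′ ¬adj (inc₂ e) (inc₂ e′)
        ... | inj₁ (refl , _) = ends-≢ e refl
        ... | inj₂ (_ , refl) = no-common Q≢Q′ ¬adj (inc₁ e) (inc₂ e′) refl
        choose : Dec (u ≡ x) → Dec (w ≡ x) → Dec (u ≡ y) → Dec (w ≡ y) → R′ ∋ u ~ w
        choose (no ux) (no wx) _ _ = transfer nbr far′ r uw (trans (g u w ux wx) Ruw)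
        choose _ _ (no uy) (no wy) = transfer nbr′ far′ r′ uw (trans (g′ u w uy wy) Ruw)
        choose (yes refl) _ _ (yes refl) = contradiction Ruw R-xy
        choose _ (yes refl) (yes refl) _ = contradiction (~-sym R Ruw) R-xy
        choose (yes refl) _ (yes refl) _ = contradiction refl (no-common Q≢Q′ ¬adj (inc₁ e) (inc₁ e′))
        choose _ (yes refl) _ (yes refl) = contradiction refl (no-common Q≢Q′ ¬adj (inc₁ e) (inc₁ e′))

    -- The mover from Q₃ to R is an end of both Q₁ and Q₂.
    pairwise : ∀ {Q₁ Q₂ Q₃} → discrete ∼ Q₁ → discrete ∼ Q₂ → discrete ∼ Q₃ → Q₁ ≢ Q₂ → Q₁ ≢ Q₃ → Q₂ ≢ Q₃ →
               CommonFar 𝓑 discrete Q₁ Q₂ Q₃ → Q₁ ∼ Q₂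
    pairwise n₁ n₂ n₃ d₁₂ d₁₃ d₂₃ (R , far , r₁ , r₂ , r₃@(_ , _ , g)) =
      [ (λ eq → contradiction eq d₁₂) , id ]′
        (share-inc (mover-∈ far g r₁ n₃ n₁ (≢-sym d₁₃)) (mover-∈ far g r₂ n₃ n₂ (≢-sym d₂₃)))

    -- The movers from Q₃ and Q₂ to R are the two ends of Q₁, the former shared with Q₂ and the
    -- latter with Q₃. Being adjacent to Q₁, Q₄ contains one of them.
    corner : ∀ {Q₁ Q₂ Q₃ Q₄} → discrete ∼ Q₁ → discrete ∼ Q₂ → discrete ∼ Q₃ → Q₁ ≢ Q₂ → Q₁ ≢ Q₃ → Q₂ ≢ Q₃ →
             CommonFar 𝓑 discrete Q₁ Q₂ Q₃ → discrete ∼ Q₄ → Q₁ ∼ Q₄ → (Q₄ ≡ Q₂ ⊎ Q₂ ∼ Q₄) ⊎ (Q₄ ≡ Q₃ ⊎ Q₃ ∼ Q₄)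
    corner {Q₁} {Q₂} {Q₃} {Q₄} n₁ n₂ n₃ d₁₂ d₁₃ d₂₃ (R , far , r₁ , r₂@(_ , x₂ , g₂) , r₃@(_ , x₃ , g₃)) n₄ adj =
      [ (λ i → inj₁ (close x₃∈Q₂ i)) , (λ i → inj₂ (close x₂∈Q₃ i)) ]′ (meets n₄ (inc-pair x₃≢x₂ x₃∈Q₁ x₂∈Q₁) (∼-sym adj))
      where
      x₃∈Q₁ : Inc Q₁ x₃
      x₃∈Q₁ = mover-∈ far g₃ r₁ n₃ n₁ (≢-sym d₁₃)
      x₃∈Q₂ : Inc Q₂ x₃
      x₃∈Q₂ = mover-∈ far g₃ r₂ n₃ n₂ (≢-sym d₂₃)
      x₂∈Q₁ : Inc Q₁ x₂
      x₂∈Q₁ = mover-∈ far g₂ r₁ n₂ n₁ (≢-sym d₁₂)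
      x₂∈Q₃ : Inc Q₃ x₂
      x₂∈Q₃ = mover-∈ far g₂ r₃ n₂ n₃ d₂₃
      x₃≢x₂ : x₃ ≢ x₂
      x₃≢x₂ = mover-∉ far g₂ x₃∈Q₂
      close : ∀ {Q v} → Inc Q v → Inc Q₄ v → Q₄ ≡ Q ⊎ Q ∼ Q₄
      close i j = [ inj₁ ∘ ≡.sym , inj₂ ]′ (share-inc i j)

-- Whitney's theorem for labelled neighbourhoods

module Alignment {B : Graph} {c : V B} {m n : ℕ} (M : Model B c (Fin m)) (N : Model B c (Fin n)) where

  private
    module M = Incidence M
    module N = Incidence N

  -- A third edge at u meets ab and ad in the second labelling. If it missed a, it would be bd, so
  -- the same three neighbours would be a star for M and a triangle for N, which `CommonFar`
  -- excludes. For an edge at v the roles are exchanged: placed at a, it would make a triangle for M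
  -- and a star for N.
  aligned : ∀ {Q₀ Q₁ u v w a b d} → M.Ends Q₀ u v → M.Ends Q₁ u w → v ≢ w →
            N.Ends Q₀ a b → N.Ends Q₁ a d → b ≢ d →
            ∀ Q → (M.Inc Q u → N.Inc Q a) × (M.Inc Q v → N.Inc Q b)
  aligned {Q₀} {Q₁} {u} {v} {w} {a} {b} {d} e₀ e₁ vw f₀ f₁ bd Q = at-u , at-v
    where
    at-u : M.Inc Q u → N.Inc Q a
    at-u (z , e) with z ≟F v | z ≟F w
    ... | yes refl | _ = subst (λ Q → N.Inc Q a) (M.ends-det e₀ e) (N.inc₁ f₀)
    ... | _ | yes refl = subst (λ Q → N.Inc Q a) (M.ends-det e₁ e) (N.inc₁ f₁)
    ... | no zv | no zw
      with N.meets (M.ends-nbr e) f₀ (M.share e e₀ λ { refl → zv (M.ends-uniq e e₀) })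
         | N.meets (M.ends-nbr e) f₁ (M.share e e₁ λ { refl → zw (M.ends-uniq e e₁) })
    ... | inj₁ i | _      = i
    ... | inj₂ _ | inj₁ i = i
    ... | inj₂ i | inj₂ j = contradiction (N.triangle f₀ (N.inc-pair bd i j) (N.ends-sym f₁))
                                          (M.star e₀ e e₁ (≢-sym zv) vw zw)
    at-v : M.Inc Q v → N.Inc Q b
    at-v (z , e) with z ≟F u
    ... | yes refl = subst (λ Q → N.Inc Q b) (M.ends-det e₀ (M.ends-sym e)) (N.inc₂ f₀)
    ... | no zu with N.meets (M.ends-nbr e) f₀ (M.share e (M.ends-sym e₀) λ { refl → zu (M.ends-uniq e (M.ends-sym e₀)) })
    ... | inj₂ i = i
    ... | inj₁ (x , f) with x ≟F b | x ≟F d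
    ... | yes refl | _ = N.inc₂ f
    ... | _ | yes refl with M.inc-either (subst (λ Q → M.Ends Q u w) (N.ends-det f₁ f) e₁) (M.inc₁ e)
    ...   | inj₁ refl = contradiction refl (M.ends-≢ e₀)
    ...   | inj₂ refl = contradiction refl vw
    at-v (z , e) | no zu | inj₁ (x , f) | no xb | no xd
      with M.meet e e₁ (inj₂ (N.share f f₁ λ { refl → xd (N.ends-uniq f f₁) }))
    ... | inj₁ (inj₁ refl) = contradiction refl (M.ends-≢ e₀)
    ... | inj₁ (inj₂ refl) = contradiction refl vw
    ... | inj₂ (inj₁ refl) = contradiction refl zu
    ... | inj₂ (inj₂ refl) = contradiction (M.triangle e₀ e (M.ends-sym e₁))
                                           (N.star f₀ f f₁ (≢-sym xb) bd xd)

module Whitney {B : Graph} {c : V B} {m n : ℕ} (M : Model B c (Fin m)) (N : Model B c (Fin n)) where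

  private
    module M = Incidence M
    module N = Incidence N
    module M→N = Alignment M N
    module N→M = Alignment N M

  -- Vertices are matched by the neighbours incident with them. These determine a vertex up to the
  -- two ends of an isolated edge, so an orientation is recorded as well.
  record Dart (Q₀ : V B) (u v : Fin m) : Set where
    field
      tail head : Fin n
      ends : N.Ends Q₀ tail head
      at-tail : ∀ Q → M.Inc Q u ⇔ N.Inc Q tail
      at-head : ∀ Q → M.Inc Q v ⇔ N.Inc Q head

  reverse : ∀ {Q₀ u v} → Dart Q₀ u v → Dart Q₀ v u
  reverse D = record { tail = head ; head = tail ; ends = N.ends-sym ends ; at-tail = at-head ; at-head = at-tail }
    where open Dart D

  dart-via : ∀ {Q₀ Q₁ u v w} → M.Ends Q₀ u v → M.Ends Q₁ u w → v ≢ w → Dart Q₀ u v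
  dart-via {Q₀} {Q₁} {u} {v} {w} e₀ e₁ vw with N.ends-exist (M.ends-nbr e₀)
  ... | a , b , f = [ oriented f , oriented (N.ends-sym f) ]′ (N.meets (M.ends-nbr e₁) f (M.share e₁ e₀ (≢-sym Q₀≢Q₁)))
    where
    Q₀≢Q₁ : Q₀ ≢ Q₁
    Q₀≢Q₁ refl = vw (M.ends-uniq e₀ e₁)
    oriented : ∀ {a b} → N.Ends Q₀ a b → N.Inc Q₁ a → Dart Q₀ u v
    oriented {a} {b} f (d , f₁) = record
      { tail = a ; head = b ; ends = f
      ; at-tail = λ Q → mk⇔ (proj₁ (M→N.aligned e₀ e₁ vw f f₁ bd Q)) (proj₁ (N→M.aligned f f₁ bd e₀ e₁ vw Q))
      ; at-head = λ Q → mk⇔ (proj₂ (M→N.aligned e₀ e₁ vw f f₁ bd Q)) (proj₂ (N→M.aligned f f₁ bd e₀ e₁ vw Q)) }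
      where
      bd : b ≢ d
      bd refl = Q₀≢Q₁ (N.ends-det f f₁)

  module _ (linked? : ∀ u w → Dec (∃ λ Q → M.Ends Q u w)) where

    dart : ∀ {Q₀ u v} → M.Ends Q₀ u v → Dart Q₀ u v
    dart {Q₀} {u} {v} e₀ with any? (λ w → ¬? (w ≟F v) ×-dec linked? u w) | any? (λ w → ¬? (w ≟F u) ×-dec linked? v w)
    ... | yes (w , wv , Q₁ , e₁) | _ = dart-via e₀ e₁ (≢-sym wv)
    ... | _ | yes (w , wu , Q₁ , e₁) = reverse (dart-via (M.ends-sym e₀) e₁ (≢-sym wu))
    -- For an isolated edge Q₀ is the only neighbour at either end, in both labellings, so either
    -- orientation serves.
    ... | no none-u | no none-v with N.ends-exist (M.ends-nbr e₀)
    ... | a , b , f₀ = record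
      { tail = a ; head = b ; ends = f₀
      ; at-tail = λ Q → mk⇔ (λ i → subst (λ Q → N.Inc Q a) (only-M (inj₁ i)) (N.inc₁ f₀))
                            (λ i → subst (λ Q → M.Inc Q u) (only-N (inj₁ i)) (M.inc₁ e₀))
      ; at-head = λ Q → mk⇔ (λ i → subst (λ Q → N.Inc Q b) (only-M (inj₂ i)) (N.inc₂ f₀))
                            (λ i → subst (λ Q → M.Inc Q v) (only-N (inj₂ i)) (M.inc₂ e₀)) }
      where
      only-M : ∀ {Q} → M.Inc Q u ⊎ M.Inc Q v → Q₀ ≡ Q
      only-M {Q} (inj₁ (w , e)) with w ≟F v
      ... | yes refl = M.ends-det e₀ e
      ... | no wv    = contradiction (w , wv , Q , e) none-u
      only-M {Q} (inj₂ (w , e)) with w ≟F u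
      ... | yes refl = M.ends-det e₀ (M.ends-sym e)
      ... | no wu    = contradiction (w , wu , Q , e) none-v
      only-N : ∀ {Q} → N.Inc Q a ⊎ N.Inc Q b → Q₀ ≡ Q
      only-N i with [ (λ j → N.share-inc j (N.inc₁ f₀)) , (λ j → N.share-inc j (N.inc₂ f₀)) ]′ i
      ... | inj₁ eq  = ≡.sym eq
      ... | inj₂ adj = only-M (M.meets ([ N.ends-nbr ∘ proj₂ , N.ends-nbr ∘ proj₂ ]′ i) e₀ adj)

    Link : Fin m → Fin m → Set
    Link u v = True (linked? u v)

    link : ∀ {u v} → Link u v → ∃ λ Q → M.Ends Q u v
    link = toWitness

    link-sym : ∀ {u v} → Link u v → Link v u
    link-sym l = fromWitness (proj₁ (link l) , M.ends-sym (proj₂ (link l)))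

    private
      -- The dart of an isolated edge is oriented arbitrarily, so the dart that starts at the
      -- smaller vertex decides the image of both of its ends.
      image′ : ∀ {u v} → Link u v → Tri (u < v) (u ≡ v) (v < u) → Fin n
      image′ l (tri< _ _ _)    = Dart.tail (dart (proj₂ (link l)))
      image′ l (tri≈ _ refl _) = contradiction refl (M.ends-≢ (proj₂ (link l)))
      image′ l (tri> _ _ _)    = Dart.head (dart (proj₂ (link (link-sym l))))

      image′-inc : ∀ {u v} (l : Link u v) t Q → M.Inc Q u ⇔ N.Inc Q (image′ l t)
      image′-inc l (tri< _ _ _)    = Dart.at-tail (dart (proj₂ (link l)))
      image′-inc l (tri≈ _ refl _) = contradiction refl (M.ends-≢ (proj₂ (link l)))
      image′-inc l (tri> _ _ _)    = Dart.at-head (dart (proj₂ (link (link-sym l))))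

      image′-≢ : ∀ {u v} (l : Link u v) (l′ : Link v u) t t′ → image′ l t ≢ image′ l′ t′
      image′-≢ l l′ (tri≈ _ refl _) _ _ = M.ends-≢ (proj₂ (link l)) refl
      image′-≢ l l′ _ (tri≈ _ refl _) _ = M.ends-≢ (proj₂ (link l)) refl
      image′-≢ l l′ (tri< u<v _ _) (tri< v<u _ _) _ = <-asym u<v v<u
      image′-≢ l l′ (tri> _ _ v<u) (tri> _ _ u<v) _ = <-asym u<v v<u
      image′-≢ l l′ (tri< _ _ _) (tri> _ _ _) eq =
        N.ends-≢ (Dart.ends (dart (proj₂ (link l))))
          (trans eq (cong (λ l → Dart.head (dart (proj₂ (link l)))) (T-irrelevant (link-sym l′) l)))
      image′-≢ l l′ (tri> _ _ _) (tri< _ _ _) eq =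
        N.ends-≢ (Dart.ends (dart (proj₂ (link l′))))
          (trans (≡.sym eq) (cong (λ l → Dart.head (dart (proj₂ (link l)))) (T-irrelevant (link-sym l) l′)))

    image : ∀ {u v} → Link u v → Fin n
    image {u} {v} l = image′ l (<-cmp u v)

    image-inc : ∀ {u v} (l : Link u v) Q → M.Inc Q u ⇔ N.Inc Q (image l)
    image-inc {u} {v} l = image′-inc l (<-cmp u v)

    -- Equal images give u and u′ the same incident neighbours. If they differed, both links would
    -- be the edge uu′, in opposite directions, and `image′-≢` separates its ends.
    image-injective : ∀ {u v u′ v′} (l : Link u v) (l′ : Link u′ v′) → image l ≡ image l′ → u ≡ u′
    image-injective {u} {v} {u′} {v′} l l′ eq with u ≟F u′
    ... | yes e = e
    ... | no u≢u′ with partner l l′ eq u≢u′ | partner l′ l (≡.sym eq) (≢-sym u≢u′)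
      where
      partner : ∀ {u v u′ v′} (l : Link u v) (l′ : Link u′ v′) → image l ≡ image l′ → u ≢ u′ → u′ ≡ v
      partner {u′ = u′} l l′ eq u≢u′ with link l
      ... | Q , e with M.inc-either e (from (image-inc l′ Q) (subst (N.Inc Q) eq (to (image-inc l Q) (M.inc₁ e))))
      ... | inj₁ u′≡u = contradiction (≡.sym u′≡u) u≢u′
      ... | inj₂ u′≡v = u′≡v
    ... | refl | refl = contradiction eq (image′-≢ l l′ (<-cmp u u′) (<-cmp u′ u))

    image-ends : ∀ {Q u u′ v v′} (l : Link u v) (l′ : Link u′ v′) → M.Ends Q u u′ → N.Ends Q (image l) (image l′)
    image-ends {Q} l l′ e = N.inc-pair (λ eq → M.ends-≢ e (image-injective l l′ eq))
      (to (image-inc l Q) (M.inc₁ e)) (to (image-inc l′ Q) (M.inc₂ e))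

-- Pulling back local properties and labellings along an isomorphism

module _ {B B′ : Graph} (φ : B′ ≅ B) where
  private
    f = Inverse.to (proj₁ φ)
    g = Inverse.from (proj₁ φ)

    f-injective : ∀ {Q Q′} → f Q ≡ f Q′ → Q ≡ Q′
    f-injective {Q} {Q′} eq = trans (≡.sym (Inverse.strictlyInverseʳ (proj₁ φ) Q))
      (trans (cong g eq) (Inverse.strictlyInverseʳ (proj₁ φ) Q′))

    E⇒ : ∀ {Q Q′} → E B′ Q Q′ → E B (f Q) (f Q′)
    E⇒ {Q} {Q′} = to (proj₂ φ Q Q′)

    E⇐ : ∀ {Q Q′} → E B (f Q) (f Q′) → E B′ Q Q′
    E⇐ {Q} {Q′} = from (proj₂ φ Q Q′)

    ≢⇒ : ∀ {Q Q′} → Q ≢ Q′ → f Q ≢ f Q′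
    ≢⇒ h = h ∘ f-injective

    far⇒ : ∀ {c R} → Far B′ c R → Far B (f c) (f R)
    far⇒ (R≢c , ¬adj) = ≢⇒ R≢c , ¬adj ∘ E⇐

    preimage : ∀ R → ∃ λ R′ → f R′ ≡ R
    preimage R = g R , Inverse.strictlyInverseˡ (proj₁ φ) R

    far⇐ : ∀ {c R} → Far B (f c) (f R) → Far B′ c R
    far⇐ (R≢c , ¬adj) = (R≢c ∘ cong f) , ¬adj ∘ E⇒

    common⇒ : ∀ {c Q₁ Q₂ Q₃} → CommonFar B′ c Q₁ Q₂ Q₃ → CommonFar B (f c) (f Q₁) (f Q₂) (f Q₃)
    common⇒ (R , far , e₁ , e₂ , e₃) = f R , far⇒ far , E⇒ e₁ , E⇒ e₂ , E⇒ e₃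

    common⇐ : ∀ {c Q₁ Q₂ Q₃} → CommonFar B (f c) (f Q₁) (f Q₂) (f Q₃) → CommonFar B′ c Q₁ Q₂ Q₃
    common⇐ (R , far , e₁ , e₂ , e₃) with preimage R
    ... | R′ , refl = R′ , far⇐ far , E⇐ e₁ , E⇐ e₂ , E⇐ e₃

  pull-locally-discrete : ∀ {c} → LocallyDiscrete B (f c) → LocallyDiscrete B′ c
  pull-locally-discrete {c} ld = record
    { square = square′
    ; square-unique = λ n n′ d ¬adj far e e′ far₂ e₂ e₂′ → f-injective
        (square-unique (E⇒ n) (E⇒ n′) (≢⇒ d) (¬adj ∘ E⇐) (far⇒ far) (E⇒ e) (E⇒ e′) (far⇒ far₂) (E⇒ e₂) (E⇒ e₂′))
    ; pairwise = λ n₁ n₂ n₃ d₁₂ d₁₃ d₂₃ common →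
        E⇐ (pairwise (E⇒ n₁) (E⇒ n₂) (E⇒ n₃) (≢⇒ d₁₂) (≢⇒ d₁₃) (≢⇒ d₂₃) (common⇒ common))
    ; corner = λ n₁ n₂ n₃ d₁₂ d₁₃ d₂₃ common n₄ adj →
        [ (λ c → inj₁ (close c)) , (λ c → inj₂ (close c)) ]′
          (corner (E⇒ n₁) (E⇒ n₂) (E⇒ n₃) (≢⇒ d₁₂) (≢⇒ d₁₃) (≢⇒ d₂₃) (common⇒ common) (E⇒ n₄) (E⇒ adj)) }
    where
    open LocallyDiscrete ld
    close : ∀ {Q Q′} → f Q ≡ f Q′ ⊎ E B (f Q′) (f Q) → Q ≡ Q′ ⊎ E B′ Q′ Q
    close (inj₁ eq)  = inj₁ (f-injective eq)
    close (inj₂ adj) = inj₂ (E⇐ adj)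
    square′ : ∀ {Q Q′} → E B′ c Q → E B′ c Q′ → Q ≢ Q′ → ¬ E B′ Q Q′ → ∃ λ R → Far B′ c R × E B′ Q R × E B′ Q′ R
    square′ n n′ d ¬adj with square (E⇒ n) (E⇒ n′) (≢⇒ d) (¬adj ∘ E⇐)
    ... | R , far , e , e′ with preimage R
    ... | R′ , refl = R′ , far⇐ far , E⇐ e , E⇐ e′

  pull-model : ∀ {c X} → Model B (f c) X → Model B′ c X
  pull-model M = record
    { Ends = λ Q → Ends (f Q) ; ends-nbr = E⇐ ∘ ends-nbr ; ends-sym = ends-sym ; ends-≢ = ends-≢
    ; ends-exist = ends-exist ∘ E⇒ ; ends-det = λ e e′ → f-injective (ends-det e e′) ; ends-uniq = ends-uniq
    ; share = λ e e′ d → E⇐ (share e e′ (≢⇒ d))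
    ; meet = λ e e′ close → meet e e′ ([ inj₁ ∘ cong f , inj₂ ∘ E⇒ ]′ close)
    ; triangle = λ e₁ e₂ e₃ → common⇐ (triangle e₁ e₂ e₃)
    ; star = λ e₁ e₂ e₃ d₁₂ d₁₃ d₂₃ common → star e₁ e₂ e₃ d₁₂ d₁₃ d₂₃ (common⇒ common) }
    where open Model M

≅-sym : ∀ {B B′} → B ≅ B′ → B′ ≅ B
≅-sym {B} {B′} (i , e) = mk↔ₛ′ f⁻¹ f (Inverse.strictlyInverseʳ i) (Inverse.strictlyInverseˡ i) ,
  λ u v → mk⇔ (λ h → from (e _ _) (subst₂ (E B′) (≡.sym (ff⁻¹ u)) (≡.sym (ff⁻¹ v)) h))
                (λ h → subst₂ (E B′) (ff⁻¹ u) (ff⁻¹ v) (to (e _ _) h))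
  where
  f = Inverse.to i
  f⁻¹ = Inverse.from i
  ff⁻¹ : ∀ u → f (f⁻¹ u) ≡ u
  ff⁻¹ = Inverse.strictlyInverseˡ i

-- Finite structures that embed into each other

module _ {X : Set} {n : ℕ} (ι : X → Fin n) (ι-injective : ∀ {x y} → ι x ≡ ι y → x ≡ y)
         (σ : X → X) (σ-injective : ∀ {x y} → σ x ≡ σ y → x ≡ y) where

  fold-cancel : ∀ {x} i k → fold x σ i ≡ fold x σ (i + k) → x ≡ fold x σ k
  fold-cancel zero    k eq = eq
  fold-cancel (suc i) k eq = fold-cancel i k (σ-injective eq)

  -- Among the iterates 0 to n two coincide, since ι takes only n values; cancelling the common
  -- initial applications of σ leaves a positive period.
  period : ∀ x → ∃ λ k → fold x σ (suc k) ≡ x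
  period x with pigeonhole (n<1+n n) (λ i → ι (fold x σ (toℕ i)))
  ... | i , j , i<j , eq with m≤n⇒∃[o]m+o≡n i<j
  ... | k , 1+i+k≡j = k , ≡.sym (fold-cancel (toℕ i) (suc k)
          (trans (ι-injective eq) (cong (fold x σ) (≡.sym (trans (+-suc (toℕ i) k) 1+i+k≡j)))))

  fold-multiple : ∀ {x} k m → fold x σ k ≡ x → fold x σ (m * k) ≡ x
  fold-multiple k zero    eq = refl
  fold-multiple {x} k (suc m) eq = trans (fold-+ x σ k) (trans (cong (λ y → fold y σ k) (fold-multiple k m eq)) eq)

  module _ (R : X → X → Set) (σ-preserves : ∀ {x y} → R x y → R (σ x) (σ y)) where

    -- The product of the periods of x and y returns both to themselves. One application of σ is
    -- already contained in the hypothesis, and the remaining ones preserve R.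
    σ-reflects : ∀ {x y} → R (σ x) (σ y) → R x y
    σ-reflects {x} {y} r with period x | period y
    ... | k , eq | l , eq′ = subst₂ R
            (fold-multiple (suc k) (suc l) eq)
            (trans (cong (fold y σ) (*-comm (suc l) (suc k))) (fold-multiple (suc l) (suc k) eq′))
            (preserves (k + l * suc k))
      where
      preserves : ∀ i → R (fold x σ (suc i)) (fold y σ (suc i))
      preserves zero    = r
      preserves (suc i) = σ-preserves (preserves i)

-- Non-universal vertices and embeddings between them

module _ {n : ℕ} (G : SimpleGraph n) where

  open Partitions G

  V′ : Set
  V′ = V (removeUniversal G)

  V′-≡ : {x y : V′} → proj₁ x ≡ proj₁ y → x ≡ y
  V′-≡ {u , s} {_ , t} refl = cong (u ,_) (T-irrelevant s t)

  nonuniversal⁺ : ∀ {u w} → Coadj u w → T (not (isUniversal G u))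
  nonuniversal⁺ {u} {w} (u≢w , ¬adj) = from T-not-≡ (¬-not λ h →
    [ (λ t → u≢w (≡.sym (toWitness t))) , (λ t → true≢false (to T-≡ t) ¬adj) ]′
      (to (T-∨ {⌊ w ≟F u ⌋}) (allF⁻ _ (from T-≡ h) w)))

  nonuniversal⁻ : ∀ u → T (not (isUniversal G u)) → ∃ (Coadj u)
  nonuniversal⁻ u t with any? (coadj? u)
  ... | yes c   = c
  ... | no none = contradiction (to T-not-≡ t) (true≢false (to T-≡ (allF⁺ _ adjacent)))
    where
    adjacent : ∀ w → T (⌊ w ≟F u ⌋ ∨ adj G u w)
    adjacent w with w ≟F u | adj G u w in eq
    ... | yes _  | _     = _
    ... | no _   | true  = _
    ... | no w≢u | false = contradiction (w , ≢-sym w≢u , eq) none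

-- Failure of adjacency splits into coadjacency and equality, so implications for both are needed to
-- carry adjacency back.
adj-transfer : ∀ {m n} (G : SimpleGraph m) (H : SimpleGraph n) {u v u′ v′} → (u ≡ v → u′ ≡ v′) →
               (Partitions.Coadj G u v → Partitions.Coadj H u′ v′) → T (adj H u′ v′) → T (adj G u v)
adj-transfer G H {u} {v} {u′} {v′} f g t with adj G u v in eq
... | true = _
... | false with u ≟F v
... | no u≢v   = contradiction (proj₂ (g (u≢v , refl))) (true≢false (to T-≡ t))
... | yes u≡v with refl ← f u≡v = contradiction (irrefl H u′) (true≢false (to T-≡ t))

record _↪_ {m n : ℕ} (G : SimpleGraph m) (H : SimpleGraph n) : Set where
  field
    map       : V′ G → V′ H
    injective : ∀ {x y} → map x ≡ map y → x ≡ y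
    preserves : ∀ {x y} → Partitions.Coadj G (proj₁ x) (proj₁ y) → Partitions.Coadj H (proj₁ (map x)) (proj₁ (map y))

↪-antisym : ∀ {m n} {G : SimpleGraph m} {H : SimpleGraph n} → G ↪ H → H ↪ G → removeUniversal G ≅ removeUniversal H
↪-antisym {G = G} {H} α β = mk↔ₛ′ A.map γ A-γ (λ x → A.injective (A-γ (A.map x))) , λ u v → mk⇔
  (adj-transfer H G (λ eq → cong proj₁ (A.injective (V′-≡ H eq))) reflects)
  (adj-transfer G H (λ eq → cong (proj₁ ∘ A.map) (V′-≡ G eq)) A.preserves)
  where
  module A = _↪_ α
  module B = _↪_ β
  γ-exists : ∀ y → ∃ λ x → A.map x ≡ y
  -- If 1 + k applications of the composite return to y, stopping after k of them and applying
  -- `B.map` gives a preimage of y under `A.map`.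
  γ-exists y with period proj₁ (V′-≡ H) (A.map ∘ B.map) (B.injective ∘ A.injective) y
  ... | k , eq = B.map (fold y (A.map ∘ B.map) k) , eq
  γ : V′ H → V′ G
  γ y = proj₁ (γ-exists y)
  A-γ : ∀ y → A.map (γ y) ≡ y
  A-γ y = proj₂ (γ-exists y)
  reflects : ∀ {x y} → Partitions.Coadj H (proj₁ (A.map x)) (proj₁ (A.map y)) → Partitions.Coadj G (proj₁ x) (proj₁ y)
  reflects h = σ-reflects proj₁ (V′-≡ G) (B.map ∘ A.map) (A.injective ∘ B.injective)
    (λ x y → Partitions.Coadj G (proj₁ x) (proj₁ y)) (B.preserves ∘ A.preserves) (B.preserves h)

-- From an isomorphism of Bell graphs to an embedding

module Embedding {m n : ℕ} (G : SimpleGraph m) (H : SimpleGraph n) (φ : Bell G ≅ Bell H) where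

  private
    module PG = Partitions G
    module PH = Partitions H
    module SG = Structure G
    module SH = Structure H
    module TH = TameModel H
    module DG = Discrete G

    ψ : SG.𝓑 ≅ SH.𝓑
    ψ = proj₁ φ , λ P Q → mk⇔
      (λ e → from PH.∼⇔Bell (to (proj₂ φ P Q) (to PG.∼⇔Bell e)))
      (λ e → from PG.∼⇔Bell (from (proj₂ φ P Q) (to PH.∼⇔Bell e)))

    centre : PH.Part
    centre = Inverse.to (proj₁ φ) PG.discrete

    tame : SH.Tame centre
    tame = SH.tame centre (pull-locally-discrete (≅-sym ψ)
      (subst (LocallyDiscrete SG.𝓑) (≡.sym (Inverse.strictlyInverseʳ (proj₁ φ) PG.discrete)) DG.discrete-locally-discrete))

    N : Model SG.𝓑 PG.discrete (Fin n)
    N = pull-model ψ (TH.model centre tame)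

    open Whitney DG.discrete-model N

    linked? : ∀ u w → Dec (∃ λ Q → Model.Ends DG.discrete-model Q u w)
    linked? u w = map′ (λ c → PG.merge PG.discrete c , DG.merge-ends c) (λ (_ , e) → TameModel.Ends.link e) (PG.coadj? u w)

    -- Each vertex uses an arbitrary edge at it to define its image. `image-injective` and
    -- `image-ends` allow unrelated choices at different vertices.
    linked : (x : V′ G) → Link linked? (proj₁ x) (proj₁ (nonuniversal⁻ G (proj₁ x) (proj₂ x)))
    linked (u , t) = fromWitness (_ , DG.merge-ends (proj₂ (nonuniversal⁻ G u t)))

    map : V′ G → V′ H
    map x = image linked? (linked x) , nonuniversal⁺ H (TameModel.Ends.link (proj₂ inc))
      where
      inc : Incidence.Inc N _ (image linked? (linked x))
      inc = to (image-inc linked? (linked x) _) (_ , proj₂ (link linked? (linked x)))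

  -- Labels at `centre` are coadjacent pairs of H, but it is not shown that all such pairs occur as
  -- labels. So coadjacency is carried in one direction only, and `↪-antisym` supplies the other.
  embedding : G ↪ H
  embedding = record
    { map = map
    ; injective = λ {x} {y} eq → V′-≡ G (image-injective linked? (linked x) (linked y) (cong proj₁ eq))
    ; preserves = λ {x} {y} c → TameModel.Ends.link (image-ends linked? (linked x) (linked y) (DG.merge-ends c)) }

-- Transporting partitions along an isomorphism of the non-universal parts

EdgePreserving : ∀ {m n} (G : SimpleGraph m) (H : SimpleGraph n) → (V′ G → V′ H) → Set
EdgePreserving G H f = ∀ x y → E (removeUniversal G) x y → E (removeUniversal H) (f x) (f y)

module Transport {m n : ℕ} (G : SimpleGraph m) (H : SimpleGraph n)
                 (h : V′ H → V′ G) (h-edge : EdgePreserving H G h) where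

  private
    module PG = Partitions G
    module PH = Partitions H

  -- A universal vertex has access to the first alternative only and thus stays a singleton.
  Related : PG.Part → Fin n → Fin n → Set
  Related P u w = u ≡ w ⊎ ∃₂ λ s t → P PG.∋ proj₁ (h (u , s)) ~ proj₁ (h (w , t))

  related? : ∀ P u w → Dec (Related P u w)
  related? P u w with u ≟F w | T? (not (isUniversal H u)) | T? (not (isUniversal H w))
  ... | yes e | _ | _ = yes (inj₁ e)
  ... | no ¬e | no ¬s | _ = no [ ¬e , (λ (s , _) → ¬s s) ]′
  ... | no ¬e | _ | no ¬t = no [ ¬e , (λ (_ , t , _) → ¬t t) ]′
  ... | no ¬e | yes s | yes t with PG.related? P (proj₁ (h (u , s))) (proj₁ (h (w , t)))
  ...   | yes p = yes (inj₂ (s , t , p))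
  ...   | no ¬p = no [ ¬e , (λ (s′ , t′ , p) → ¬p (subst₂
            (λ s t → P PG.∋ proj₁ (h (u , s)) ~ proj₁ (h (w , t))) (T-irrelevant s′ s) (T-irrelevant t′ t) p)) ]′

  private
    r : PG.Part → Fin n → Fin n → Bool
    r P u w = does (related? P u w)

    r⁻ : ∀ P u w → r P u w ≡ true → Related P u w
    r⁻ P u w e with yes p ← related? P u w = p

    r⁺ : ∀ P u w → Related P u w → r P u w ≡ true
    r⁺ P u w = dec-true (related? P u w)

    related-sym : ∀ P {u w} → Related P u w → Related P w u
    related-sym P (inj₁ e)           = inj₁ (≡.sym e)
    related-sym P (inj₂ (s , t , p)) = inj₂ (t , s , PG.~-sym P p)

    related-trans : ∀ P {u w x} → Related P u w → Related P w x → Related P u x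
    related-trans P (inj₁ refl) q = q
    related-trans P p (inj₁ refl) = p
    related-trans P (inj₂ (s , t , p)) (inj₂ (t′ , x , q)) with refl ← T-irrelevant t t′ = inj₂ (s , x , PG.~-trans P p q)

    related-indep : ∀ P {u w} → Related P u w → adj H u w ≡ false
    related-indep P (inj₁ refl) = irrefl H _
    related-indep P {u} {w} (inj₂ (s , t , p)) = ¬-not λ a →
      true≢false (to T-≡ (h-edge (u , s) (w , t) (from T-≡ a))) (PG.~-indep P p)

    r-refl : ∀ P u → r P u u ≡ true
    r-refl P u = r⁺ P u u (inj₁ refl)
    r-sym : ∀ P u w → r P u w ≡ true → r P w u ≡ true
    r-sym P u w e = r⁺ P w u (related-sym P (r⁻ P u w e))
    r-trans : ∀ P u w x → r P u w ≡ true → r P w x ≡ true → r P u x ≡ true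
    r-trans P u w x e f = r⁺ P u x (related-trans P (r⁻ P u w e) (r⁻ P w x f))
    r-indep : ∀ P u w → r P u w ≡ true → adj H u w ≡ false
    r-indep P u w e = related-indep P (r⁻ P u w e)

  opaque
    push : PG.Part → PH.Part
    push P = PH.fromRelation (r P) (r-refl P) (r-sym P) (r-trans P) (r-indep P)

    push⁻ : ∀ P {u w} → push P PH.∋ u ~ w → Related P u w
    push⁻ P {u} {w} e = r⁻ P u w (trans (≡.sym (PH.fromRelation-at (r P) (r-refl P) (r-sym P) (r-trans P) (r-indep P) u w)) e)

    push⁺ : ∀ P {u w} → Related P u w → push P PH.∋ u ~ w
    push⁺ P {u} {w} e = trans (PH.fromRelation-at (r P) (r-refl P) (r-sym P) (r-trans P) (r-indep P) u w) (r⁺ P u w e)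

module TransportInverse {m n : ℕ} (G : SimpleGraph m) (H : SimpleGraph n)
  (f : V′ G → V′ H) (f-edge : EdgePreserving G H f) (h : V′ H → V′ G) (h-edge : EdgePreserving H G h)
  (hf : ∀ x → h (f x) ≡ x) (fh : ∀ y → f (h y) ≡ y) where

  private
    module PG = Partitions G
    module PH = Partitions H
    module T = Transport G H h h-edge
    module T⁻¹ = Transport H G f f-edge

    f-injective : ∀ {x y} → f x ≡ f y → x ≡ y
    f-injective {x} {y} eq = trans (≡.sym (hf x)) (trans (cong h eq) (hf y))

    h-f : ∀ x (s : T (not (isUniversal H (proj₁ (f x))))) → proj₁ (h (proj₁ (f x) , s)) ≡ proj₁ x
    h-f x s = cong proj₁ (trans (cong h (V′-≡ H refl)) (hf x))

  push-inverse : ∀ P → T⁻¹.push (T.push P) ≡ P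
  push-inverse P = PG.part-≡⁺ fwd bwd
    where
    fwd : ∀ {u w} → u ≢ w → T⁻¹.push (T.push P) PG.∋ u ~ w → P PG.∋ u ~ w
    fwd {u} {w} uw e with T⁻¹.push⁻ (T.push P) e
    ... | inj₁ u≡w = contradiction u≡w uw
    ... | inj₂ (s , t , p) with T.push⁻ P p
    ... | inj₁ eq = contradiction (cong proj₁ (f-injective (V′-≡ H eq))) uw
    ... | inj₂ (s′ , t′ , q) = subst₂ (P PG.∋_~_) (h-f (u , s) s′) (h-f (w , t) t′) q
    bwd : ∀ {u w} → u ≢ w → P PG.∋ u ~ w → T⁻¹.push (T.push P) PG.∋ u ~ w
    bwd {u} {w} uw e = T⁻¹.push⁺ (T.push P) (inj₂ (s , t , T.push⁺ P (inj₂ (proj₂ (f (u , s)) , proj₂ (f (w , t)) ,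
        subst₂ (P PG.∋_~_) (≡.sym (h-f (u , s) _)) (≡.sym (h-f (w , t) _)) e))))
      where
      c = PG.~-coadj P uw e
      s = nonuniversal⁺ G c
      t = nonuniversal⁺ G (PG.coadj-sym c)

  push-edge : ∀ {P Q} → P PG.∼ Q → T.push P PH.∼ T.push Q
  push-edge {P} {Q} (P≢Q , v , agree) =
    (λ eq → P≢Q (trans (≡.sym (push-inverse P)) (trans (cong T⁻¹.push eq) (push-inverse Q)))) ,
    moved (T? (not (isUniversal G v)))
    where
    incl : ∀ {P Q} (t : T (not (isUniversal G v))) → PG.Agree v P Q → ∀ {u w} →
           u ≢ proj₁ (f (v , t)) → w ≢ proj₁ (f (v , t)) → u ≢ w → T.push P PH.∋ u ~ w → T.push Q PH.∋ u ~ w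
    incl {P} {Q} t agree {u} {w} uv wv uw e with T.push⁻ P e
    ... | inj₁ u≡w = contradiction u≡w uw
    ... | inj₂ (s , s′ , p) = T.push⁺ Q (inj₂ (s , s′ , trans (≡.sym (agree _ _ (avoid s uv) (avoid s′ wv))) p))
      where
      avoid : ∀ {u} (s : T (not (isUniversal H u))) → u ≢ proj₁ (f (v , t)) → proj₁ (h (u , s)) ≢ v
      avoid {u} s uv eq = uv (cong proj₁ (trans (≡.sym (fh (u , s))) (cong f (V′-≡ G eq))))
    moved : Dec (T (not (isUniversal G v))) → ∃ λ x → PH.Agree x (T.push P) (T.push Q)
    moved (yes t) = proj₁ (f (v , t)) , PH.agree⁺ (incl t agree) (incl t (PG.agree-sym agree))
    -- A universal v is alone in both partitions, so agreement away from v would already be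
    -- equality.
    moved (no ¬t) = contradiction (PG.part-≡⁺ (same agree) (same (PG.agree-sym agree))) P≢Q
      where
      same : ∀ {P Q} → PG.Agree v P Q → ∀ {u w} → u ≢ w → P PG.∋ u ~ w → Q PG.∋ u ~ w
      same {P} agree uw e = trans (≡.sym (agree _ _
        (λ { refl → ¬t (nonuniversal⁺ G (PG.~-coadj P uw e)) })
        (λ { refl → ¬t (nonuniversal⁺ G (PG.coadj-sym (PG.~-coadj P uw e))) }))) e

module _ {m n : ℕ} (G : SimpleGraph m) (H : SimpleGraph n) where

  Bell-cong : removeUniversal G ≅ removeUniversal H → Bell G ≅ Bell H
  Bell-cong φ = mk↔ₛ′ T.push T⁻¹.push I⁻¹.push-inverse I.push-inverse , λ P Q → mk⇔
    (λ e → to PH.∼⇔Bell (I.push-edge (from PG.∼⇔Bell e)))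
    (λ e → to PG.∼⇔Bell (subst₂ PG._∼_ (I.push-inverse P) (I.push-inverse Q)
      (I⁻¹.push-edge (from PH.∼⇔Bell e))))
    where
    f = Inverse.to (proj₁ φ)
    h = Inverse.from (proj₁ φ)
    f-edge : EdgePreserving G H f
    f-edge x y = to (proj₂ φ x y)
    h-edge : EdgePreserving H G h
    h-edge x y = to (proj₂ (≅-sym φ) x y)
    hf : ∀ x → h (f x) ≡ x
    hf = Inverse.strictlyInverseʳ (proj₁ φ)
    fh : ∀ y → f (h y) ≡ y
    fh = Inverse.strictlyInverseˡ (proj₁ φ)
    module PG = Partitions G
    module PH = Partitions H
    module T = Transport G H h h-edge
    module T⁻¹ = Transport H G f f-edge
    module I = TransportInverse G H f f-edge h h-edge hf fh
    module I⁻¹ = TransportInverse H G h h-edge f f-edge fh hf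

theorem1p4 : {n₁ n₂ : ℕ} (G₁ : SimpleGraph n₁) (G₂ : SimpleGraph n₂) →
    (Bell G₁ ≅ Bell G₂) ⇔ (removeUniversal G₁ ≅ removeUniversal G₂)
theorem1p4 G₁ G₂ = mk⇔
  (λ φ → ↪-antisym (Embedding.embedding G₁ G₂ φ) (Embedding.embedding G₂ G₁ (≅-sym φ)))
  (Bell-cong G₁ G₂)
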